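{- Let $k\ge2$. Finite tree sequence automata are as expressive as the monadic second-order theory of $k$-refinable upward unbounded layered structures (UULSs). That is: (a) for every automaton $A\in\mathcal{B}(\mathcal{C}_k)$ accepting in $\mathcal{S}(\mathcal{H}_k(\Sigma))$ there is a sentence $\varphi_A\in\mathrm{MSO}_{\mathcal{P}_\Sigma}[<,(\downarrow_i)_{i=0}^{k-1}]$, with $\mathcal{P}_\Sigma=\{P_a:a\in\Sigma\}$, such that $\mathcal{L}(A)\cap ITS_k(\Sigma)=\mathcal{M}(\varphi_A)$; and (b) for every finite $\mathcal{P}$ and every sentence $\varphi\in\mathrm{MSO}_{\mathcal{P}}[<,(\downarrow_i)_{i=0}^{k-1}]$ there is an automaton $A_\varphi\in\mathcal{B}(\mathcal{C}_k)$, over some finite set $\Gamma(2^{\mathcal{P}})$ of almost $k$-ary finite tree automata, such that $\mathcal{M}(\varphi)=\mathcal{L}(A_\varphi)\cap ITS_k(\mathcal{P})$.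
   Context: UULSs. For $i\ge0$ let $T^i=\{j_i: j\ge0\}$. A $\mathcal{P}$-labeled $k$-refinable UULS is $\langle\bigcup_{i\ge0}T^i,(\downarrow_i)_{i=0}^{k-1},<,(P)_{P\in\mathcal{P}}\rangle$, where $\downarrow_i(a_0)=\bot$ (undefined) for all $a$, and $\downarrow_i(a_b)=c_d$ iff $b>0$, $b=d+1$ and $c=a\cdot k+i$; thus it is a complete $k$-ary infinite tree generated from the leaves $T^0$. The total order $<$ is given by the inorder (left-root-right) visit of the nodes, and each $P\in\mathcal{P}$ is interpreted as a set of points. (The paper also uses an equivalent version of the language with $<$ replaced by $<_{pre}$, where $x<_{pre}y$ iff $y\ne x$ and $y$ belongs to the tree rooted at $x$.) MSO. $\mathrm{MSO}_{\mathcal{P}}[<,(\downarrow_i)_{i=0}^{k-1}]$ has atomic formulas $x=y$, $x<y$, $\downarrow_i(x)=y$, $x\in X$, $x\in P$ ($P\in\mathcal{P}$), and is closed under $\neg,\wedge$ and $\exists$ over individual and set variables. $\mathcal{M}(\varphi)$ is the set of UULSs satisfying $\varphi$. Increasing tree sequences. An almost $k$-ary finite tree is a complete finite tree whose root has exactly $k-1$ sons, each the root of a complete finite $k$-ary tree (all leaves at the same depth; the tree of height $0$ is a single node). $\mathcal{H}_k(\Sigma)$ is the set of $\Sigma$-labeled almost $k$-ary finite trees and $\mathcal{S}(\mathcal{H}_k(\Sigma))$ the set of $(\mathbb{N},<,g)$ with $g:\mathbb{N}\to\mathcal{H}_k(\Sigma)$. $ITS_k(\Sigma)\subset\mathcal{S}(\mathcal{H}_k(\Sigma))$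 is the set of increasing sequences: $g(i)$ has height $i$ for every $i$. For $ITS_k(\mathcal{P})$, nodes are labeled by subsets of $\mathcal{P}$. A UULS $t$ is identified with the increasing tree sequence in which $g(i)$ is the tree rooted at $0_i$ with, if $i>0$, the subtree rooted at its leftmost son $0_{i-1}$ deleted; this is a bijection between UULSs and increasing tree sequences. For an alphabet $\Sigma$, a $\Sigma$-labeled increasing tree sequence is regarded as a $\mathcal{P}_\Sigma$-labeled UULS in which $P_a$ is the set of points labeled $a$; in (a), $\varphi_A$ is interpreted over these structures. Automata. $\mathcal{C}_k$ is the class of (nondeterministic) almost $k$-ary finite tree automata $X=(Q_X,q_X^0,\Delta_X,F_X)$ over $\Sigma$: a run labels the nodes with states, with the initial state $q_X^0$ at the root; the root (if not a leaf) respects root transitions in $Q_X\times\Sigma\times Q_X^{k-1}$, other internal nodes respect transitions in $Q_X\times\Sigma\times Q_X^{k}$, and for a leaf with state $q$ and label $a$ there must be a leaf transition $(q,a,q')\in Q_X\times\Sigma\times Q_X$ with $q'\in F_X$ (the three kinds of transitions form $\Delta_X$); a tree is accepted iff it has a run. A finite tree sequence automaton, i.e. an element of $\mathcal{B}(\mathcal{C}_k)$, is $A=(Q,q_0,\Delta,F)$ over a finite set $\Gamma(\Sigma)\subseteq\mathcal{C}_k$ of such automata over $\Sigma$, with $\Delta\subseteq Q\times\Gamma(\Sigma)\times Q$, $F\subseteq Q$. It accepts $(\mathbb{N},<,g)\in\mathcal{S}(\mathcal{H}_k(\Sigma))$ iff there is $\sigma:\mathbb{N}\to Q$ with $\sigma(0)=q_0$,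 such that for every $i$ there is $B\in\Gamma(\Sigma)$ with $(\sigma(i),B,\sigma(i+1))\in\Delta$ and $g(i)\in\mathcal{L}(B)$, and some state of $F$ occurs infinitely often in $\sigma$. $\mathcal{L}(A)$ is the set of accepted elements. -}

module Defs where

open import Data.Bool using (Bool; T)
open import Data.Fin using (Fin; zero; suc; toℕ)
open import Data.Fin.Properties using () renaming (_≟_ to _≟ᶠ_)
open import Data.Fin.Subset using (Subset; _∈_)
open import Data.Maybe using (Maybe; just; nothing)
open import Data.Nat using (ℕ; zero; suc; _+_; _*_; _∸_; _≤_)
open import Data.Product using (∃; ∃-syntax; _×_; _,_; proj₁; proj₂)
open import Data.Vec using (Vec; []; _∷_; lookup; map; tabulate)
open import Level using (0ℓ)
open import Relation.Binary.PropositionalEquality using (_≡_; _≗_)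
open import Relation.Nullary using (¬_; does)
open import Relation.Unary using (Pred)

import Data.Fin as Fin

-- (a , b) is the point a_b: position a in layer b, layer 0 being the leaves.
Point : Set
Point = ℕ × ℕ

↓ : ∀ {k} → Fin k → Point → Maybe Point
↓     i (a , zero)  = nothing
↓ {k} i (a , suc b) = just (a * k + toℕ i , b)

-- InSubtree k x y: y is a node of the tree rooted at x.
data InSubtree (k : ℕ) : Point → Point → Set where
  here  : ∀ {x} → InSubtree k x x
  below : ∀ {x y z} (i : Fin k) → ↓ i x ≡ just z → InSubtree k z y → InSubtree k x y

-- Inorder visit of a k-ary tree: first the subtree of the leftmost son,
-- then the root, then the subtrees of the other sons from left to right.
data Inorder (k : ℕ) : Point → Point → Set where
  left-root  : ∀ {x y z} (i : Fin k) → toℕ i ≡ 0 →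
               ↓ i y ≡ just z → InSubtree k z x → Inorder k x y
  root-right : ∀ {x y z} (i : Fin k) → 1 ≤ toℕ i →
               ↓ i x ≡ just z → InSubtree k z y → Inorder k x y
  subtrees   : ∀ {x y r u v} (i j : Fin k) → i Fin.< j →
               ↓ i r ≡ just u → InSubtree k u x →
               ↓ j r ≡ just v → InSubtree k v y → Inorder k x y

-- Sets are given by Boolean characteristic functions; under excluded middle
-- these are all the subsets.
PointSet : Set
PointSet = Point → Bool

-- The points, the projections ↓ and the order are determined by k, so only
-- the interpretation of the p predicate symbols is data.
record UULS (k p : ℕ) : Set where
  constructor uuls
  field
    interp : Fin p → PointSet

open UULS public

-- Formulas with n free individual variables and m free set variables
-- (de Bruijn indices), over p unary predicate symbols.
data Formula (k p : ℕ) : (n m : ℕ) → Set where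
  eq    : ∀ {n m} → Fin n → Fin n → Formula k p n m
  less  : ∀ {n m} → Fin n → Fin n → Formula k p n m
  proj  : ∀ {n m} → Fin k → Fin n → Fin n → Formula k p n m
  inSet : ∀ {n m} → Fin n → Fin m → Formula k p n m
  pred  : ∀ {n m} → Fin n → Fin p → Formula k p n m
  neg   : ∀ {n m} → Formula k p n m → Formula k p n m
  and   : ∀ {n m} → Formula k p n m → Formula k p n m → Formula k p n m
  ex₁   : ∀ {n m} → Formula k p (suc n) m → Formula k p n m
  ex₂   : ∀ {n m} → Formula k p n (suc m) → Formula k p n m

Sentence : (k p : ℕ) → Set
Sentence k p = Formula k p 0 0

Sat : ∀ {k p n m} → UULS k p → Vec Point n → Vec PointSet m → Formula k p n m → Set
Sat     t ρ θ (eq x y)     = lookup ρ x ≡ lookup ρ y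
Sat {k} t ρ θ (less x y)   = Inorder k (lookup ρ x) (lookup ρ y)
Sat     t ρ θ (proj i x y) = ↓ i (lookup ρ x) ≡ just (lookup ρ y)
Sat     t ρ θ (inSet x X)  = T (lookup θ X (lookup ρ x))
Sat     t ρ θ (pred x P)   = T (interp t P (lookup ρ x))
Sat     t ρ θ (neg φ)      = ¬ Sat t ρ θ φ
Sat     t ρ θ (and φ ψ)    = Sat t ρ θ φ × Sat t ρ θ ψ
Sat     t ρ θ (ex₁ φ)      = ∃[ a ] Sat t (a ∷ ρ) θ φ
Sat     t ρ θ (ex₂ φ)      = ∃[ X ] Sat t ρ (X ∷ θ) φ

𝓜 : ∀ {k p} → Sentence k p → Pred (UULS k p) 0ℓ
𝓜 φ t = Sat t [] [] φ

-- Trees of height h whose leaves all have depth h; the root of an almost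
-- k-ary tree has k - 1 sons.
data Complete (k : ℕ) (A : Set) : ℕ → Set where
  leaf : A → Complete k A 0
  node : ∀ {h} → A → Vec (Complete k A h) k → Complete k A (suc h)

data Almost (k : ℕ) (A : Set) : ℕ → Set where
  leaf : A → Almost k A 0
  root : ∀ {h} → A → Vec (Complete k A h) (k ∸ 1) → Almost k A (suc h)

label : ∀ {k A h} → Complete k A h → A
label (leaf a)   = a
label (node a _) = a

rootLabel : ∀ {k A h} → Almost k A h → A
rootLabel (leaf a)   = a
rootLabel (root a _) = a

𝓗 : ℕ → Set → Set
𝓗 k A = ∃[ h ] Almost k A h

height : ∀ {k A} → 𝓗 k A → ℕ
height = proj₁

𝓢 : ℕ → Set → Set
𝓢 k A = ℕ → 𝓗 k A

ITS : (k : ℕ) (A : Set) → Pred (𝓢 k A) 0ℓ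
ITS k A g = ∀ i → height (g i) ≡ i

subtree : ∀ {A} k → (Point → A) → ℕ → (b : ℕ) → Complete k A b
subtree k ℓ a zero    = leaf (ℓ (a , zero))
subtree k ℓ a (suc b) =
  node (ℓ (a , suc b)) (tabulate λ (i : Fin k) → subtree k ℓ (a * k + toℕ i) b)

-- The tree rooted at 0_i without the subtree rooted at its leftmost son
-- 0_(i-1); the remaining sons of 0_(b+1) are 1_b, …, (k-1)_b.
slice : ∀ {A} k → (Point → A) → (i : ℕ) → Almost k A i
slice k ℓ zero    = leaf (ℓ (0 , zero))
slice k ℓ (suc b) =
  root (ℓ (0 , suc b)) (tabulate λ (j : Fin (k ∸ 1)) → subtree k ℓ (suc (toℕ j)) b)

sequence : ∀ {A} k → (Point → A) → 𝓢 k A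
sequence k ℓ i = i , slice k ℓ i

-- Each point is labelled by the set of predicates holding at it.
labels : ∀ {k p} → UULS k p → Point → Subset p
labels t x = tabulate λ P → interp t P x

asSequences : ∀ {k p} → Pred (UULS k p) 0ℓ → Pred (𝓢 k (Subset p)) 0ℓ
asSequences {k} M g = ∃[ t ] M t × g ≗ sequence k (labels t)

-- The predicate symbol P_a is interpreted as the set of points labelled a.
letterUULS : ∀ k {s} → (Point → Fin s) → UULS k s
letterUULS k ℓ = uuls λ a x → does (ℓ x ≟ᶠ a)

-- The Σ-labelled tree sequences (Σ = Fin s) whose associated UULS over
-- { P_a : a ∈ Σ } belongs to M.
asLetterSequences : ∀ {k s} → Pred (UULS k s) 0ℓ → Pred (𝓢 k (Fin s)) 0ℓ
asLetterSequences {k} M g = ∃[ ℓ ] M (letterUULS k ℓ) × g ≗ sequence k ℓ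

record TreeAutomaton (k : ℕ) (A : Set) : Set where
  field
    states : ℕ
    init   : Fin states
    rootΔ  : Fin states → A → Vec (Fin states) (k ∸ 1) → Bool
    nodeΔ  : Fin states → A → Vec (Fin states) k → Bool
    leafΔ  : Fin states → A → Fin states → Bool
    final  : Subset states

module _ {k : ℕ} {A : Set} (X : TreeAutomaton k A) where
  open TreeAutomaton X

  LeafOK : A → Fin states → Set
  LeafOK a q = ∃[ q′ ] T (leafΔ q a q′) × q′ ∈ final

  -- The second tree is the state labelling.
  Respects : ∀ {h} → Complete k A h → Complete k (Fin states) h → Set
  Respects (leaf a)    (leaf q)    = LeafOK a q
  Respects (node a ts) (node q rs) =
    T (nodeΔ q a (map label rs)) × (∀ i → Respects (lookup ts i) (lookup rs i))

  AlmostRespects : ∀ {h} → Almost k A h → Almost k (Fin states) h → Set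
  AlmostRespects (leaf a)    (leaf q)    = LeafOK a q
  AlmostRespects (root a ts) (root q rs) =
    T (rootΔ q a (map label rs)) × (∀ j → Respects (lookup ts j) (lookup rs j))

  IsRun : ∀ {h} → Almost k A h → Almost k (Fin states) h → Set
  IsRun t r = rootLabel r ≡ init × AlmostRespects t r

  Lᵗ : Pred (𝓗 k A) 0ℓ
  Lᵗ (h , t) = ∃[ r ] IsRun t r

-- Elements of 𝓑(𝓒_k); Γ enumerates the finite set of tree automata.
record SeqAutomaton (k : ℕ) (A : Set) : Set where
  field
    states : ℕ
    size   : ℕ
    Γ      : Vec (TreeAutomaton k A) size
    init   : Fin states
    Δ      : Fin states → Fin size → Fin states → Bool
    final  : Subset states

module _ {k : ℕ} {A : Set} (X : SeqAutomaton k A) where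
  open SeqAutomaton X

  InfinitelyOften : (ℕ → Fin states) → Fin states → Set
  InfinitelyOften σ q = ∀ m → ∃[ i ] m ≤ i × σ i ≡ q

  L : Pred (𝓢 k A) 0ℓ
  L g = ∃[ σ ] σ 0 ≡ init
             × (∀ i → ∃[ B ] T (Δ (σ i) B (σ (suc i))) × Lᵗ (lookup Γ B) (g i))
             × (∃[ q ] q ∈ final × InfinitelyOften σ q)

{-# OPTIONS --safe #-}

-- For (b), labelled trees are evaluated bottom-up in a finite algebra and the
-- slices g(0), g(1), … in a finite monoid M, acceptance being a property of the
-- resulting ω-word over M that is invariant under grouping factors into blocks.
-- Complement is then the negation of the acceptance property, intersection a
-- product algebra and projection a powerset algebra, so only the atomic formulas
-- and singletons need an explicit algebra. No automaton is complemented: by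
-- Ramsey's theorem every ω-word over M factors as s e e e … with s e = s and
-- e e = e, so that a Büchi automaton over M need only guess such a factorization,
-- and its letters m are replaced by tree automata recognizing the trees of value m.
-- For (a), an accepting run is a labelling of all points subject to local
-- constraints and to a recurrence condition on the points 0_i.
module Submission where

open import Defs
open import Algebra.Structures using (IsMonoid)
open import Axiom.ExcludedMiddle using (ExcludedMiddle)
open import Data.Bool using (Bool; true; false; T; _∧_; if_then_else_)
open import Data.Bool.Properties using (T-∧)
open import Data.Empty using (⊥; ⊥-elim)
open import Data.Fin using (Fin; zero; suc; toℕ)
open import Data.Fin.Properties using (+↔⊎; *↔×; 1↔⊤; 2↔Bool; toℕ<n; toℕ-injective; toℕ-fromℕ<) renaming (_≟_ to _≟ᶠ_; <-cmp to <ᶠ-cmp)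
open import Data.Fin.Subset using (Subset; _∈_)
open import Data.Maybe using (Maybe; just; nothing; _>>=_)
open import Data.Maybe.Properties using (just-injective)
open import Data.Nat using (ℕ; zero; suc; _+_; _*_; _∸_; _≤_; _<_; _<ᵇ_; _≤′_; ≤′-refl; ≤′-step; z≤n; s≤s)
open import Data.Nat.DivMod using (_/_; _%_; _mod_; m≡m%n+[m/n]*n; m/n<m; m*n/n≡m; m<n⇒m/n≡0; m<n⇒m%n≡m; [m+kn]%n≡m%n; +-distrib-/-∣ˡ)
open import Data.Nat.Divisibility using (divides)
open import Data.Nat.Induction using (<-rec)
open import Data.Nat.Properties hiding (_≟_; <-cmp)
open import Data.Product using (Σ; ∃-syntax; ∃₂; _×_; _,_; proj₁; proj₂)
open import Data.Product.Function.NonDependent.Propositional using (_×-↔_)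
open import Data.Sum using (_⊎_; inj₁; inj₂)
open import Data.Sum.Function.Propositional using (_⊎-↔_)
open import Data.Unit using (⊤; tt)
open import Data.Vec using (Vec; []; _∷_; lookup; map; tabulate)
open import Data.Vec.Properties using (lookup∘tabulate; tabulate∘lookup; tabulate-cong; tabulate-∘; lookup-map; lookup⇒[]=; []=⇒lookup)
open import Function using (_↔_; _⇔_; mk⇔; mk↔ₛ′; Inverse; Equivalence; _∘_; id)
open import Function.Construct.Composition using (_↔-∘_)
open import Function.Construct.Symmetry using (↔-sym)
open import Level using (0ℓ)
open import Relation.Binary.Definitions using (tri<; tri≈; tri>)
open import Relation.Binary.PropositionalEquality
open import Relation.Nullary using (¬_; Dec; yes; no; does; ofʸ; ofⁿ)
open import Relation.Nullary.Decidable using (decidable-stable; does-⇔)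
open import Relation.Unary using (_∩_; _≐_)

import Data.Nat as Nat

open Equivalence using (to; from)

-- A UULS has no root, so no tree is evaluated last: the tree rooted at 0_(b+1) extends the one
-- rooted at 0_b by a slice, and this never ends. A slice of positive height lacks its leftmost
-- subtree, so its value has to say how it acts on what was computed before; this is why a monoid
-- `M` sits on top of the algebra `S`.
--
-- `Acc` is an arbitrary predicate on infinite words and does not fit into a finite automaton as it
-- stands. Invariance under grouping repairs this: a word that factors as s e e e ... is accepted
-- iff this lasso is, so `Acc` reduces to finitely many facts about pairs `(s , e)`, which excluded
-- middle turns into Boolean transition tables. Complement merely exchanges the two directions of
-- the invariance; the delicate case is projection, where choices made in separate blocks are
-- reassembled into one word.
--
-- In (a), local constraints pass information about the leftmost branch downwards only, so they
-- cannot force the whole branch to be marked. The recurrence condition does this besides expressing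
-- the Büchi condition.

-- Finite types, their codes and their subsets

Finite : Set → Set
Finite X = ∃[ n ] X ↔ Fin n

module _ {X : Set} (fin : Finite X) where
  card : ℕ
  card = proj₁ fin

  enc : X → Fin card
  enc = Inverse.to (proj₂ fin)

  dec : Fin card → X
  dec = Inverse.from (proj₂ fin)

  dec-enc : ∀ x → dec (enc x) ≡ x
  dec-enc = Inverse.strictlyInverseʳ (proj₂ fin)

  enc-dec : ∀ i → enc (dec i) ≡ i
  enc-dec = Inverse.strictlyInverseˡ (proj₂ fin)

  enc-injective : ∀ {x y} → enc x ≡ enc y → x ≡ y
  enc-injective x≡y = trans (sym (dec-enc _)) (trans (cong dec x≡y) (dec-enc _))

-- Abstract, since the codes themselves should never be computed.
abstract
  finite-cong : ∀ {X Y} → X ↔ Y → Finite Y → Finite X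
  finite-cong e (n , f) = n , f ↔-∘ e

  finite-Fin : ∀ n → Finite (Fin n)
  finite-Fin n = n , mk↔ₛ′ id id (λ _ → refl) (λ _ → refl)

  finite-⊤ : Finite ⊤
  finite-⊤ = 1 , ↔-sym 1↔⊤

  finite-Bool : Finite Bool
  finite-Bool = 2 , ↔-sym 2↔Bool

  finite-× : ∀ {X Y} → Finite X → Finite Y → Finite (X × Y)
  finite-× (m , e) (n , f) = _ , ↔-sym *↔× ↔-∘ (e ×-↔ f)

  finite-⊎ : ∀ {X Y} → Finite X → Finite Y → Finite (X ⊎ Y)
  finite-⊎ (m , e) (n , f) = _ , ↔-sym +↔⊎ ↔-∘ (e ⊎-↔ f)

  finite-Maybe : ∀ {X} → Finite X → Finite (Maybe X)
  finite-Maybe fin = finite-cong Maybe↔⊤⊎ (finite-⊎ finite-⊤ fin)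
    where
    Maybe↔⊤⊎ : ∀ {X : Set} → Maybe X ↔ (⊤ ⊎ X)
    Maybe↔⊤⊎ = mk↔ₛ′ (λ { nothing → inj₁ tt ; (just x) → inj₂ x })
                     (λ { (inj₁ _) → nothing ; (inj₂ x) → just x })
                     (λ { (inj₁ _) → refl ; (inj₂ _) → refl })
                     (λ { nothing → refl ; (just _) → refl })

  finite-Vec : ∀ {X} → Finite X → ∀ n → Finite (Vec X n)
  finite-Vec fin zero    = finite-cong []↔⊤ finite-⊤
    where
    []↔⊤ : ∀ {X : Set} → Vec X 0 ↔ ⊤
    []↔⊤ = mk↔ₛ′ (λ _ → tt) (λ _ → []) (λ _ → refl) (λ { [] → refl })
  finite-Vec fin (suc n) = finite-cong ∷↔× (finite-× fin (finite-Vec fin n))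
    where
    ∷↔× : ∀ {X : Set} {n} → Vec X (suc n) ↔ (X × Vec X n)
    ∷↔× = mk↔ₛ′ (λ { (x ∷ xs) → x , xs }) (λ { (x , xs) → x ∷ xs })
                (λ _ → refl) (λ { (_ ∷ _) → refl })

  finite-Σ : ∀ n (F : Fin n → Set) → (∀ i → Finite (F i)) → Finite (Σ (Fin n) F)
  finite-Σ zero    F fin = 0 , mk↔ₛ′ proj₁ (λ ()) (λ ()) (λ { (() , _) })
  finite-Σ (suc n) F fin =
    finite-cong split (finite-⊎ (fin zero) (finite-Σ n (F ∘ suc) (fin ∘ suc)))
    where
    split : Σ (Fin (suc n)) F ↔ (F zero ⊎ Σ (Fin n) (F ∘ suc))
    split = mk↔ₛ′ (λ { (zero , x) → inj₁ x ; (suc i , x) → inj₂ (i , x) })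
                  (λ { (inj₁ x) → zero , x ; (inj₂ (i , x)) → suc i , x })
                  (λ { (inj₁ _) → refl ; (inj₂ _) → refl })
                  (λ { (zero , _) → refl ; (suc _ , _) → refl })

does⁺ : ∀ {P : Set} (P? : Dec P) → P → T (does P?)
does⁺ (yes _) _ = tt
does⁺ (no ¬p) p = ¬p p

does⁻ : ∀ {P : Set} (P? : Dec P) → T (does P?) → P
does⁻ (yes p) _ = p

module Powerset (em : ExcludedMiddle 0ℓ) {X : Set} (fin : Finite X) where
  𝒫 : Set
  𝒫 = Vec Bool (card fin)

  finite-𝒫 : Finite 𝒫
  finite-𝒫 = finite-Vec finite-Bool (card fin)

  infix 4 _∈ₚ_

  -- Abstract, so that P can be inferred from ⟦ P ⟧.
  abstract
    _∈ₚ_ : X → 𝒫 → Set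
    x ∈ₚ U = T (lookup U (enc fin x))

    ⟦_⟧ : (X → Set) → 𝒫
    ⟦ P ⟧ = tabulate λ i → does (em {P (dec fin i)})

    ∈⟦⟧⁺ : ∀ {P : X → Set} {x} → P x → x ∈ₚ ⟦ P ⟧
    ∈⟦⟧⁺ {P} {x} p = subst T (sym (lookup∘tabulate _ (enc fin x)))
                       (does⁺ em (subst P (sym (dec-enc fin x)) p))

    ∈⟦⟧⁻ : ∀ {P : X → Set} {x} → x ∈ₚ ⟦ P ⟧ → P x
    ∈⟦⟧⁻ {P} {x} q = subst P (dec-enc fin x)
                       (does⁻ em (subst T (lookup∘tabulate _ (enc fin x)) q))

    𝒫-ext : ∀ {U V} → (∀ x → x ∈ₚ U → x ∈ₚ V) → (∀ x → x ∈ₚ V → x ∈ₚ U) → U ≡ V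
    𝒫-ext {U} {V} U⊆V V⊆U = begin
      U                   ≡⟨ tabulate∘lookup U ⟨
      tabulate (lookup U) ≡⟨ tabulate-cong pointwise ⟩
      tabulate (lookup V) ≡⟨ tabulate∘lookup V ⟩
      V                   ∎
      where
      open ≡-Reasoning
      T-ext : ∀ {b c} → (T b → T c) → (T c → T b) → b ≡ c
      T-ext {false} {false} _ _ = refl
      T-ext {false} {true}  _ g = ⊥-elim (g tt)
      T-ext {true}  {false} f _ = ⊥-elim (f tt)
      T-ext {true}  {true}  _ _ = refl
      pointwise : ∀ i → lookup U i ≡ lookup V i
      pointwise i = subst (λ j → lookup U j ≡ lookup V j) (enc-dec fin i)
                      (T-ext (U⊆V (dec fin i)) (V⊆U (dec fin i)))

tabulate-lookup : ∀ {A : Set} {n} {f : Fin n → A} {xs} → (∀ i → f i ≡ lookup xs i) → tabulate f ≡ xs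
tabulate-lookup e = trans (tabulate-cong e) (tabulate∘lookup _)

tabulate-injective : ∀ {A : Set} {n} (f g : Fin n → A) → tabulate f ≡ tabulate g → f ≗ g
tabulate-injective f g e i =
  trans (sym (lookup∘tabulate f i)) (trans (cong (λ xs → lookup xs i) e) (lookup∘tabulate g i))

node-injective : ∀ {k} {A : Set} {h} {x y} {ts us : Vec (Complete k A h) k} →
                 Complete.node x ts ≡ node y us → x ≡ y × ts ≡ us
node-injective refl = refl , refl

root-injective : ∀ {k} {A : Set} {h} {x y} {ts us : Vec (Complete k A h) (k ∸ 1)} →
                 Almost.root {k} x ts ≡ root y us → x ≡ y × ts ≡ us
root-injective refl = refl , refl

-- Coordinates of points, and labellings versus sequences of slices

module Geometry (k₂ : ℕ) where
  k : ℕ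
  k = suc (suc k₂)

  quotient-child : ∀ a (i : Fin k) → (a * k + toℕ i) / k ≡ a
  quotient-child a i = begin
    (a * k + toℕ i) / k     ≡⟨ +-distrib-/-∣ˡ (toℕ i) (divides a refl) ⟩
    a * k / k + toℕ i / k   ≡⟨ cong₂ _+_ (m*n/n≡m a k) (m<n⇒m/n≡0 (toℕ<n i)) ⟩
    a + 0                   ≡⟨ +-identityʳ a ⟩
    a                       ∎
    where open ≡-Reasoning

  remainder-child : ∀ a (i : Fin k) → (a * k + toℕ i) mod k ≡ i
  remainder-child a i = toℕ-injective (begin
    toℕ ((a * k + toℕ i) mod k) ≡⟨ toℕ-fromℕ< _ ⟩
    (a * k + toℕ i) % k         ≡⟨ cong (_% k) (+-comm (a * k) (toℕ i)) ⟩
    (toℕ i + a * k) % k         ≡⟨ [m+kn]%n≡m%n (toℕ i) a k ⟩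
    toℕ i % k                   ≡⟨ m<n⇒m%n≡m (toℕ<n i) ⟩
    toℕ i                       ∎)
    where open ≡-Reasoning

  child-injective : ∀ {a a′ i i′} → a * k + toℕ i ≡ a′ * k + toℕ i′ → a ≡ a′ × i ≡ i′
  child-injective {a} {a′} {i} {i′} e =
    trans (sym (quotient-child a i)) (trans (cong (_/ k) e) (quotient-child a′ i′)) ,
    trans (sym (remainder-child a i)) (trans (cong (_mod k) e) (remainder-child a′ i′))

  -- A point off the leftmost branch is either one of the `k - 1` sons of the root of a slice or a
  -- son of another point off the branch.
  data Position : ℕ → Set where
    son-of-leftmost : (j : Fin (suc k₂)) → Position (suc (toℕ j))
    child-of        : ∀ a (i : Fin k) → suc a < suc a * k + toℕ i → Position (suc a * k + toℕ i)

  position : ∀ a → Position (suc a)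
  position a = go (suc a / k) (suc a mod k) refl
                 (trans (m≡m%n+[m/n]*n (suc a) k) (trans (+-comm (suc a % k) _)
                   (cong (suc a / k * k +_) (sym (toℕ-fromℕ< _)))))
    where
    go : ∀ q (i : Fin k) → suc a / k ≡ q → suc a ≡ suc a / k * k + toℕ i → Position (suc a)
    go zero    zero    q≡ e with () ← trans e (cong (λ q → q * k + 0) q≡)
    go zero    (suc j) q≡ e =
      subst Position (sym (trans e (cong (λ q → q * k + suc (toℕ j)) q≡))) (son-of-leftmost j)
    go (suc q) i       q≡ e = subst Position (sym e′) (child-of q i (subst₂ _<_ q≡ e′ (m/n<m (suc a) k (s≤s (s≤s z≤n)))))
      where
      e′ : suc a ≡ suc q * k + toℕ i
      e′ = trans e (cong (λ q → q * k + toℕ i) q≡)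

  -- Going up divides the index by `k`, so the index strictly decreases while the level grows. The
  -- induction is therefore on the index, with the level generalized.
  non-leftmost-ind : (P : ℕ → ℕ → Set) →
    (∀ b (j : Fin (suc k₂)) → P (suc (toℕ j)) b) →
    (∀ a b (i : Fin k) → P (suc a) (suc b) → P (suc a * k + toℕ i) b) →
    ∀ a b → P (suc a) b
  non-leftmost-ind P son child a b = <-rec Q step (suc a) (s≤s z≤n) b
    where
    Q : ℕ → Set
    Q a = 1 ≤ a → ∀ b → P a b
    step : ∀ a → (∀ {a′} → a′ < a → Q a′) → Q a
    step (suc a) rec _ b with suc a | position a
    ... | _ | son-of-leftmost j = son b j
    ... | _ | child-of a′ i a′< = child a′ b i (rec a′< (s≤s z≤n) (suc b))

  module _ {B : Set} where
    son : ∀ {b} → Almost k B (suc b) → Fin (suc k₂) → Complete k B b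
    son (root _ ts) = lookup ts

    child : ∀ {b} → Complete k B (suc b) → Fin k → Complete k B b
    child (node _ ts) = lookup ts

    module _ (g : ∀ i → Almost k B i) where
      -- The first argument is fuel bounding the depth at which the subtree
      -- rooted at (a , b) sits in its slice; the values at a = 0 are junk.
      descend : ℕ → ∀ a b → Complete k B b
      descendFrom : ℕ → ℕ → Fin k → ∀ b → Complete k B b
      descend zero       a b = son (g (suc b)) zero
      descend (suc fuel) a b = descendFrom fuel (a / k) (a mod k) b
      descendFrom fuel zero    zero    b = son (g (suc b)) zero
      descendFrom fuel zero    (suc j) b = son (g (suc b)) j
      descendFrom fuel (suc q) i       b = child (descend fuel (suc q) (suc b)) i

      -- Each division by `k` strictly lowers a positive index, so fuel of at least the index never
      -- runs out.
      descend-fuel : ∀ m n a b → suc a ≤ m → suc a ≤ n → descend m (suc a) b ≡ descend n (suc a) b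
      descend-fuel (suc m) (suc n) a b (s≤s a≤m) (s≤s a≤n) =
        go (suc a / k) (suc a mod k) (≤-pred (m/n<m (suc a) k (s≤s (s≤s z≤n))))
        where
        go : ∀ q i → q ≤ a → descendFrom m q i b ≡ descendFrom n q i b
        go zero    zero    _   = refl
        go zero    (suc _) _   = refl
        go (suc q) i       q<a =
          cong (λ t → child t i) (descend-fuel m n q (suc b) (≤-trans q<a a≤m) (≤-trans q<a a≤n))

      treeAt : ∀ a b → Complete k B b
      treeAt a = descend a a

      treeAt-son : ∀ b (j : Fin (suc k₂)) → treeAt (suc (toℕ j)) b ≡ son (g (suc b)) j
      treeAt-son b j = cong₂ (λ q i → descendFrom (toℕ j) q i b)
        (quotient-child 0 (suc j)) (remainder-child 0 (suc j))

      treeAt-child : ∀ a b (i : Fin k) →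
        treeAt (suc a * k + toℕ i) b ≡ child (treeAt (suc a) (suc b)) i
      treeAt-child a b i = trans
        (cong₂ (λ q i → descendFrom fuel q i b) (quotient-child (suc a) i) (remainder-child (suc a) i))
        (cong (λ t → child t i) (descend-fuel fuel (suc a) a (suc b) a<fuel ≤-refl))
        where
        fuel = suc (k₂ + a * k) + toℕ i
        a<fuel : suc a ≤ fuel
        a<fuel = ≤-pred (subst (_< suc a * k + toℕ i) (quotient-child (suc a) i)
                   (m/n<m (suc a * k + toℕ i) k (s≤s (s≤s z≤n))))

      opaque
        -- Surjectivity in the bijection between labellings and increasing sequences. It also glues
        -- objects chosen slice by slice into one global set or run.
        unslice : Point → B
        unslice (zero  , b) = rootLabel (g b)
        unslice (suc a , b) = label (treeAt (suc a) b)

        subtree-unslice : ∀ a b → subtree k unslice (suc a) b ≡ treeAt (suc a) b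
        subtree-unslice a zero with leaf x ← treeAt (suc a) zero = refl
        subtree-unslice a (suc b) =
          go (treeAt (suc a) (suc b))
             λ i → trans (subtree-unslice (suc (k₂ + a * k) + toℕ i) b) (treeAt-child a b i)
          where
          go : ∀ t → (∀ i → subtree k unslice (suc a * k + toℕ i) b ≡ child t i) →
               node (label t) (tabulate λ (i : Fin k) → subtree k unslice (suc a * k + toℕ i) b) ≡ t
          go (node x ts) h = cong (node x) (trans (tabulate-cong h) (tabulate∘lookup ts))

        slice-unslice : ∀ i → slice k unslice i ≡ g i
        slice-unslice zero with leaf x ← g 0 = refl
        slice-unslice (suc b) = go (g (suc b)) λ j → trans (subtree-unslice (toℕ j) b) (treeAt-son b j)
          where
          go : ∀ t → (∀ j → subtree k unslice (suc (toℕ j)) b ≡ son t j) →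
               root (rootLabel t) (tabulate λ (j : Fin (suc k₂)) → subtree k unslice (suc (toℕ j)) b) ≡ t
          go (root x ts) h = cong (root x) (trans (tabulate-cong h) (tabulate∘lookup ts))

  module _ {A : Set} {ℓ ℓ′ : Point → A} (ℓ≗ℓ′ : ℓ ≗ ℓ′) where
    subtree-cong : ∀ a b → subtree k ℓ a b ≡ subtree k ℓ′ a b
    subtree-cong a zero    = cong leaf (ℓ≗ℓ′ _)
    subtree-cong a (suc b) = cong₂ node (ℓ≗ℓ′ _) (tabulate-cong λ i → subtree-cong (a * k + toℕ i) b)

    slice-cong : ∀ i → slice k ℓ i ≡ slice k ℓ′ i
    slice-cong zero    = cong leaf (ℓ≗ℓ′ _)
    slice-cong (suc b) = cong₂ root (ℓ≗ℓ′ _) (tabulate-cong λ (j : Fin (suc k₂)) → subtree-cong (suc (toℕ j)) b)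

  label-subtree : ∀ {A : Set} (ℓ : Point → A) a b → label (subtree k ℓ a b) ≡ ℓ (a , b)
  label-subtree ℓ a zero    = refl
  label-subtree ℓ a (suc b) = refl

-- Monoids, groupings of infinite words into blocks, finite products

isMonoid : ∀ {M : Set} {_∙_ : M → M → M} {ε : M} →
  (∀ x y z → (x ∙ y) ∙ z ≡ x ∙ (y ∙ z)) → (∀ x → ε ∙ x ≡ x) → (∀ x → x ∙ ε ≡ x) →
  IsMonoid _≡_ _∙_ ε
isMonoid assoc identityˡ identityʳ = record
  { isSemigroup = record
    { isMagma = record { isEquivalence = isEquivalence ; ∙-cong = cong₂ _ }
    ; assoc   = assoc
    }
  ; identity = identityˡ , identityʳ
  }

-- Block i of a grouping n occupies the positions start n i, …,
-- start n i + n i, so that it has length suc (n i).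
start : (ℕ → ℕ) → ℕ → ℕ
start n zero    = 0
start n (suc i) = start n i + suc (n i)

i≤start : ∀ n i → i ≤ start n i
i≤start n zero    = z≤n
i≤start n (suc i) = subst (suc i ≤_) (sym (+-suc _ _)) (s≤s (≤-trans (i≤start n i) (m≤m+n _ (n i))))

module Locate (n : ℕ → ℕ) where
  next : ℕ × ℕ → ℕ × ℕ
  next (i , o) = if o <ᵇ n i then i , suc o else suc i , 0

  -- The block containing a position and the offset inside it. With `position-of` it identifies
  -- positions with the pairs whose offset is at most `n i`.
  locate : ℕ → ℕ × ℕ
  locate zero    = 0 , 0
  locate (suc j) = next (locate j)

  position-of : ℕ × ℕ → ℕ
  position-of (i , o) = start n i + o

  locate-bounded : ∀ j → proj₂ (locate j) ≤ n (proj₁ (locate j))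
  locate-bounded zero    = z≤n
  locate-bounded (suc j) with locate j
  ... | i , o with o <ᵇ n i | <ᵇ-reflects-< o (n i)
  ... | true  | ofʸ o<n = o<n
  ... | false | ofⁿ _   = z≤n

  position-locate : ∀ j → position-of (locate j) ≡ j
  position-locate zero    = refl
  position-locate (suc j) with locate j | locate-bounded j | position-locate j
  ... | i , o | o≤n | e with o <ᵇ n i | <ᵇ-reflects-< o (n i)
  ... | true  | ofʸ _   = trans (+-suc _ o) (cong suc e)
  ... | false | ofⁿ o≮n  = begin
    start n i + suc (n i) + 0 ≡⟨ +-identityʳ _ ⟩
    start n i + suc (n i)     ≡⟨ +-suc _ _ ⟩
    suc (start n i + n i)     ≡⟨ cong (λ m → suc (start n i + m)) (≤-antisym o≤n (≮⇒≥ o≮n)) ⟨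
    suc (start n i + o)       ≡⟨ cong suc e ⟩
    suc j                     ∎
    where open ≡-Reasoning

  locate-position : ∀ i o → o ≤ n i → locate (start n i + o) ≡ (i , o)
  locate-position zero    zero    _ = refl
  -- The preceding position is the last one of block `i`, at offset `n i`, where `next` has to open
  -- a new block.
  locate-position (suc i) zero    _
    rewrite +-identityʳ (start n i + suc (n i)) | +-suc (start n i) (n i)
          | locate-position i (n i) ≤-refl with n i <ᵇ n i | <ᵇ-reflects-< (n i) (n i)
  ... | true  | ofʸ n<n = ⊥-elim (<-irrefl refl n<n)
  ... | false | ofⁿ _   = refl
  locate-position i (suc o) o<n
    rewrite +-suc (start n i) o | locate-position i o (<⇒≤ o<n) with o <ᵇ n i | <ᵇ-reflects-< o (n i)
  ... | true  | ofʸ _   = refl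
  ... | false | ofⁿ o≮n  = ⊥-elim (o≮n o<n)

module Products {M : Set} (_∙_ : M → M → M) (ε : M) where
  prod : (ℕ → M) → ℕ → M
  prod f zero    = ε
  prod f (suc n) = prod f n ∙ f n

  prod-cong : ∀ {f g} n → (∀ i → i < n → f i ≡ g i) → prod f n ≡ prod g n
  prod-cong zero    f≗g = refl
  prod-cong (suc n) f≗g =
    cong₂ _∙_ (prod-cong n λ i i<n → f≗g i (m≤n⇒m≤1+n i<n)) (f≗g n ≤-refl)

  segment : (ℕ → M) → ℕ → ℕ → M
  segment f i = prod λ o → f (i + o)

  blocks : (ℕ → M) → (ℕ → ℕ) → ℕ → M
  blocks f n i = segment f (start n i) (suc (n i))

  module _ (monoid : IsMonoid _≡_ _∙_ ε) where
    open IsMonoid monoid using (assoc; identityʳ)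

    prod-+ : ∀ f m n → prod f (m + n) ≡ prod f m ∙ segment f m n
    prod-+ f m zero    = trans (cong (prod f) (+-identityʳ m)) (sym (identityʳ _))
    prod-+ f m (suc n) = begin
      prod f (m + suc n)                   ≡⟨ cong (prod f) (+-suc m n) ⟩
      prod f (m + n) ∙ f (m + n)           ≡⟨ cong (_∙ f (m + n)) (prod-+ f m n) ⟩
      (prod f m ∙ segment f m n) ∙ f (m + n) ≡⟨ assoc _ _ _ ⟩
      prod f m ∙ segment f m (suc n)       ∎
      where open ≡-Reasoning

    prod-blocks : ∀ f n i → prod (blocks f n) i ≡ prod f (start n i)
    prod-blocks f n zero    = refl
    prod-blocks f n (suc i) =
      trans (cong (_∙ blocks f n i) (prod-blocks f n i)) (sym (prod-+ f (start n i) (suc (n i))))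

-- Recognizers: Boolean operations, projection and safety conditions

module Recognizers (em : ExcludedMiddle 0ℓ) (k₂ : ℕ) where
  open Geometry k₂

  -- S collects the possible values of complete trees, M those of words of
  -- almost k-ary trees; acceptance of a tree sequence is a property of the
  -- sequence of the values of its trees that does not depend on how this
  -- sequence is grouped into nonempty blocks.
  record Recognizer (A : Set) : Set₁ where
    field
      S M      : Set
      finite-S : Finite S
      finite-M : Finite M
      leafS    : A → S
      nodeS    : A → Vec S k → S
      leafM    : A → M
      rootM    : A → Vec S (suc k₂) → M
      _∙_      : M → M → M
      ε        : M
      monoid   : IsMonoid _≡_ _∙_ ε

    open Products _∙_ ε public

    field
      Acc          : (ℕ → M) → Set
      Acc-resp     : ∀ {f g} → f ≗ g → Acc f → Acc g
      Acc-blocks   : ∀ f n → Acc f → Acc (blocks f n)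
      Acc-unblocks : ∀ f n → Acc (blocks f n) → Acc f

    val : (Point → A) → ℕ → ℕ → S
    val ℓ a zero    = leafS (ℓ (a , zero))
    val ℓ a (suc b) = nodeS (ℓ (a , suc b)) (tabulate λ (i : Fin k) → val ℓ (a * k + toℕ i) b)

    word : (Point → A) → ℕ → M
    word ℓ zero    = leafM (ℓ (0 , zero))
    word ℓ (suc b) = rootM (ℓ (0 , suc b)) (tabulate λ (j : Fin (suc k₂)) → val ℓ (suc (toℕ j)) b)

    Accepts : (Point → A) → Set
    Accepts ℓ = Acc (word ℓ)

    module _ {ℓ ℓ′ : Point → A} (ℓ≗ℓ′ : ℓ ≗ ℓ′) where
      val-cong : ∀ a b → val ℓ a b ≡ val ℓ′ a b
      val-cong a zero    = cong leafS (ℓ≗ℓ′ _)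
      val-cong a (suc b) = cong₂ nodeS (ℓ≗ℓ′ _) (tabulate-cong λ i → val-cong (a * k + toℕ i) b)

      word-cong : word ℓ ≗ word ℓ′
      word-cong zero    = cong leafM (ℓ≗ℓ′ _)
      word-cong (suc b) =
        cong₂ rootM (ℓ≗ℓ′ _) (tabulate-cong λ (j : Fin (suc k₂)) → val-cong (suc (toℕ j)) b)

      Accepts-cong : Accepts ℓ → Accepts ℓ′
      Accepts-cong = Acc-resp word-cong

  complement : ∀ {A} → Recognizer A → Recognizer A
  complement R = record
    { Recognizer R hiding (Acc; Acc-resp; Acc-blocks; Acc-unblocks)
    ; Acc          = λ f → ¬ Acc f
    ; Acc-resp     = λ f≗g ¬acc acc → ¬acc (Acc-resp (sym ∘ f≗g) acc)
    ; Acc-blocks   = λ f n ¬acc acc → ¬acc (Acc-unblocks f n acc)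
    ; Acc-unblocks = λ f n ¬acc acc → ¬acc (Acc-blocks f n acc)
    }
    where open Recognizer R

  -- `val` recurses inside the record it is taken from, so its values for `R` and for `complement R`
  -- agree by induction and not by definition; the same happens for `relabel`.
  complement-Accepts : ∀ {A} (R : Recognizer A) ℓ →
    Recognizer.Accepts (complement R) ℓ ⇔ (¬ Recognizer.Accepts R ℓ)
  complement-Accepts R ℓ = mk⇔ (λ ¬acc acc → ¬acc (Recognizer.Acc-resp R (sym ∘ word≗) acc))
                               (λ ¬acc acc → ¬acc (Recognizer.Acc-resp R word≗ acc))
    where
    val≡ : ∀ a b → Recognizer.val (complement R) ℓ a b ≡ Recognizer.val R ℓ a b
    val≡ a zero    = refl
    val≡ a (suc b) = cong (Recognizer.nodeS R _) (tabulate-cong λ i → val≡ (a * k + toℕ i) b)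
    word≗ : Recognizer.word (complement R) ℓ ≗ Recognizer.word R ℓ
    word≗ zero    = refl
    word≗ (suc b) = cong (Recognizer.rootM R _) (tabulate-cong λ j → val≡ (suc (toℕ j)) b)

  relabel : ∀ {A A′} → (A → A′) → Recognizer A′ → Recognizer A
  relabel h R = record
    { Recognizer R hiding (leafS; nodeS; leafM; rootM)
    ; leafS = leafS ∘ h
    ; nodeS = nodeS ∘ h
    ; leafM = leafM ∘ h
    ; rootM = rootM ∘ h
    }
    where open Recognizer R

  relabel-Accepts : ∀ {A A′} (h : A → A′) (R : Recognizer A′) ℓ →
    Recognizer.Accepts (relabel h R) ℓ ⇔ Recognizer.Accepts R (h ∘ ℓ)
  relabel-Accepts h R ℓ = mk⇔ (Recognizer.Acc-resp R word≗) (Recognizer.Acc-resp R (sym ∘ word≗))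
    where
    val≡ : ∀ a b → Recognizer.val (relabel h R) ℓ a b ≡ Recognizer.val R (h ∘ ℓ) a b
    val≡ a zero    = refl
    val≡ a (suc b) = cong (Recognizer.nodeS R _) (tabulate-cong λ i → val≡ (a * k + toℕ i) b)
    word≗ : Recognizer.word (relabel h R) ℓ ≗ Recognizer.word R (h ∘ ℓ)
    word≗ zero    = refl
    word≗ (suc b) = cong (Recognizer.rootM R _) (tabulate-cong λ j → val≡ (suc (toℕ j)) b)

  module Intersection {A : Set} (R₁ R₂ : Recognizer A) where
    private
      module R₁ = Recognizer R₁
      module R₂ = Recognizer R₂
      module I₁ = IsMonoid R₁.monoid
      module I₂ = IsMonoid R₂.monoid

      _∙_ : R₁.M × R₂.M → R₁.M × R₂.M → R₁.M × R₂.M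
      (x , y) ∙ (x′ , y′) = x R₁.∙ x′ , y R₂.∙ y′

      open Products _∙_ (R₁.ε , R₂.ε)

      proj₁-prod : ∀ f n → proj₁ (prod f n) ≡ R₁.prod (proj₁ ∘ f) n
      proj₁-prod f zero    = refl
      proj₁-prod f (suc n) = cong (R₁._∙ _) (proj₁-prod f n)

      proj₂-prod : ∀ f n → proj₂ (prod f n) ≡ R₂.prod (proj₂ ∘ f) n
      proj₂-prod f zero    = refl
      proj₂-prod f (suc n) = cong (R₂._∙ _) (proj₂-prod f n)

    intersection : Recognizer A
    intersection = record
      { S            = R₁.S × R₂.S
      ; M            = R₁.M × R₂.M
      ; finite-S     = finite-× R₁.finite-S R₂.finite-S
      ; finite-M     = finite-× R₁.finite-M R₂.finite-M
      ; leafS        = λ a → R₁.leafS a , R₂.leafS a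
      ; nodeS        = λ a ss → R₁.nodeS a (map proj₁ ss) , R₂.nodeS a (map proj₂ ss)
      ; leafM        = λ a → R₁.leafM a , R₂.leafM a
      ; rootM        = λ a ss → R₁.rootM a (map proj₁ ss) , R₂.rootM a (map proj₂ ss)
      ; _∙_          = _∙_
      ; ε            = R₁.ε , R₂.ε
      ; monoid       = isMonoid
          (λ _ _ _ → cong₂ _,_ (I₁.assoc _ _ _) (I₂.assoc _ _ _))
          (λ _ → cong₂ _,_ (I₁.identityˡ _) (I₂.identityˡ _))
          (λ _ → cong₂ _,_ (I₁.identityʳ _) (I₂.identityʳ _))
      ; Acc          = λ f → R₁.Acc (proj₁ ∘ f) × R₂.Acc (proj₂ ∘ f)
      ; Acc-resp     = λ f≗g (acc₁ , acc₂) →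
          R₁.Acc-resp (cong proj₁ ∘ f≗g) acc₁ , R₂.Acc-resp (cong proj₂ ∘ f≗g) acc₂
      ; Acc-blocks   = λ f n (acc₁ , acc₂) →
          R₁.Acc-resp (λ i → sym (proj₁-prod _ (suc (n i)))) (R₁.Acc-blocks _ n acc₁) ,
          R₂.Acc-resp (λ i → sym (proj₂-prod _ (suc (n i)))) (R₂.Acc-blocks _ n acc₂)
      ; Acc-unblocks = λ f n (acc₁ , acc₂) →
          R₁.Acc-unblocks _ n (R₁.Acc-resp (λ i → proj₁-prod _ (suc (n i))) acc₁) ,
          R₂.Acc-unblocks _ n (R₂.Acc-resp (λ i → proj₂-prod _ (suc (n i))) acc₂)
      }

    private
      module R = Recognizer intersection

      map-tabulate : ∀ {X Y : Set} {n} (p : X → Y) (f : Fin n → X) {g : Fin n → Y} →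
                     (∀ i → p (f i) ≡ g i) → map p (tabulate f) ≡ tabulate g
      map-tabulate p f e = trans (sym (tabulate-∘ p f)) (tabulate-cong e)

      val₁ : ∀ ℓ a b → proj₁ (R.val ℓ a b) ≡ R₁.val ℓ a b
      val₁ ℓ a zero    = refl
      val₁ ℓ a (suc b) = cong (R₁.nodeS _) (map-tabulate proj₁ (λ (i : Fin k) → R.val ℓ (a * k + toℕ i) b) λ i → val₁ ℓ (a * k + toℕ i) b)

      val₂ : ∀ ℓ a b → proj₂ (R.val ℓ a b) ≡ R₂.val ℓ a b
      val₂ ℓ a zero    = refl
      val₂ ℓ a (suc b) = cong (R₂.nodeS _) (map-tabulate proj₂ (λ (i : Fin k) → R.val ℓ (a * k + toℕ i) b) λ i → val₂ ℓ (a * k + toℕ i) b)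

      word₁ : ∀ ℓ i → proj₁ (R.word ℓ i) ≡ R₁.word ℓ i
      word₁ ℓ zero    = refl
      word₁ ℓ (suc b) = cong (R₁.rootM _) (map-tabulate proj₁ (λ (j : Fin (suc k₂)) → R.val ℓ (suc (toℕ j)) b) λ j → val₁ ℓ (suc (toℕ j)) b)

      word₂ : ∀ ℓ i → proj₂ (R.word ℓ i) ≡ R₂.word ℓ i
      word₂ ℓ zero    = refl
      word₂ ℓ (suc b) = cong (R₂.rootM _) (map-tabulate proj₂ (λ (j : Fin (suc k₂)) → R.val ℓ (suc (toℕ j)) b) λ j → val₂ ℓ (suc (toℕ j)) b)

    intersection-Accepts : ∀ ℓ → R.Accepts ℓ ⇔ (R₁.Accepts ℓ × R₂.Accepts ℓ)
    intersection-Accepts ℓ = mk⇔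
      (λ (acc₁ , acc₂) → R₁.Acc-resp (word₁ ℓ) acc₁ , R₂.Acc-resp (word₂ ℓ) acc₂)
      (λ (acc₁ , acc₂) → R₁.Acc-resp (sym ∘ word₁ ℓ) acc₁ , R₂.Acc-resp (sym ∘ word₂ ℓ) acc₂)

  module Projection {A A′ : Set} (lift : A → Bool → A′) (R : Recognizer A′) where
    private
      module R = Recognizer R
      module I = IsMonoid R.monoid
      module PS = Powerset em R.finite-S
      module PM = Powerset em R.finite-M
      open PM using (𝒫; ⟦_⟧; ∈⟦⟧⁺; ∈⟦⟧⁻) renaming (_∈ₚ_ to _∈ᴹ_)
      open PS using () renaming (_∈ₚ_ to _∈ˢ_)

      _∙_ : 𝒫 → 𝒫 → 𝒫
      U ∙ V = ⟦ (λ z → ∃₂ λ x y → x ∈ᴹ U × y ∈ᴹ V × z ≡ x R.∙ y) ⟧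

      ε : 𝒫
      ε = ⟦ _≡ R.ε ⟧

      ∙⁺ : ∀ {U V x y} → x ∈ᴹ U → y ∈ᴹ V → (x R.∙ y) ∈ᴹ (U ∙ V)
      ∙⁺ x∈ y∈ = ∈⟦⟧⁺ (_ , _ , x∈ , y∈ , refl)

      assoc : ∀ U V W → (U ∙ V) ∙ W ≡ U ∙ (V ∙ W)
      assoc U V W = PM.𝒫-ext
        (λ z z∈ → let (xy , w , xy∈ , w∈ , z≡) = ∈⟦⟧⁻ z∈ ; (x , y , x∈ , y∈ , xy≡) = ∈⟦⟧⁻ xy∈ in
          ∈⟦⟧⁺ (x , y R.∙ w , x∈ , ∙⁺ y∈ w∈ , trans z≡ (trans (cong (R._∙ w) xy≡) (I.assoc _ _ _))))
        (λ z z∈ → let (x , yw , x∈ , yw∈ , z≡) = ∈⟦⟧⁻ z∈ ; (y , w , y∈ , w∈ , yw≡) = ∈⟦⟧⁻ yw∈ in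
          ∈⟦⟧⁺ (x R.∙ y , w , ∙⁺ x∈ y∈ , w∈ , trans z≡ (trans (cong (x R.∙_) yw≡) (sym (I.assoc _ _ _)))))

      identityˡ : ∀ U → ε ∙ U ≡ U
      identityˡ U = PM.𝒫-ext
        (λ z z∈ → let (x , y , x∈ , y∈ , z≡) = ∈⟦⟧⁻ z∈ in
          subst (_∈ᴹ U) (sym (trans z≡ (trans (cong (R._∙ y) (∈⟦⟧⁻ x∈)) (I.identityˡ y)))) y∈)
        (λ z z∈ → subst (_∈ᴹ (ε ∙ U)) (I.identityˡ z) (∙⁺ (∈⟦⟧⁺ refl) z∈))

      identityʳ : ∀ U → U ∙ ε ≡ U
      identityʳ U = PM.𝒫-ext
        (λ z z∈ → let (x , y , x∈ , y∈ , z≡) = ∈⟦⟧⁻ z∈ in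
          subst (_∈ᴹ U) (sym (trans z≡ (trans (cong (x R.∙_) (∈⟦⟧⁻ y∈)) (I.identityʳ x)))) x∈)
        (λ z z∈ → subst (_∈ᴹ (U ∙ ε)) (I.identityʳ z) (∙⁺ z∈ (∈⟦⟧⁺ refl)))

      open Products _∙_ ε

      prod⁺ : ∀ {f X} n → (∀ i → f i ∈ᴹ X i) → R.prod f n ∈ᴹ prod X n
      prod⁺ zero    f∈ = ∈⟦⟧⁺ refl
      prod⁺ (suc n) f∈ = ∙⁺ (prod⁺ n f∈) (f∈ n)

      prod⁻ : ∀ X n {z} → z ∈ᴹ prod X n → ∃[ f ] (∀ i → i < n → f i ∈ᴹ X i) × R.prod f n ≡ z
      prod⁻ X zero    z∈ = (λ _ → R.ε) , (λ _ ()) , sym (∈⟦⟧⁻ z∈)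
      prod⁻ X (suc n) z∈ with x , y , x∈ , y∈ , z≡ ← ∈⟦⟧⁻ z∈ with f , f∈ , f≡ ← prod⁻ X n x∈ =
        f′ , f′∈ , trans (cong₂ R._∙_ (trans (R.prod-cong n f′≡f) f≡) f′≡y) (sym z≡)
        where
        f′ : ℕ → R.M
        -- Only the factors up to `n` are constrained; `y` is the factor at `n` and the default
        -- beyond it.
        f′ i = if i <ᵇ n then f i else y
        f′≡f : ∀ i → i < n → f′ i ≡ f i
        f′≡f i i<n with i <ᵇ n | <ᵇ-reflects-< i n
        ... | true  | ofʸ _  = refl
        ... | false | ofⁿ i≮n = ⊥-elim (i≮n i<n)
        f′≡y : f′ n ≡ y
        f′≡y with n <ᵇ n | <ᵇ-reflects-< n n
        ... | true  | ofʸ n<n = ⊥-elim (<-irrefl refl n<n)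
        ... | false | ofⁿ _    = refl
        f′∈ : ∀ i → i < suc n → f′ i ∈ᴹ X i
        f′∈ i (s≤s i≤n) with i <ᵇ n | <ᵇ-reflects-< i n
        ... | true  | ofʸ i<n = f∈ i i<n
        ... | false | ofⁿ i≮n  = subst (λ j → y ∈ᴹ X j) (≤-antisym (≮⇒≥ i≮n) i≤n) y∈

      Acc : (ℕ → 𝒫) → Set
      Acc X = ∃[ f ] (∀ i → f i ∈ᴹ X i) × R.Acc f

      -- Choose a factor for every element of every block and concatenate.
      Acc-unblocks : ∀ X n → Acc (blocks X n) → Acc X
      Acc-unblocks X n (g , g∈ , acc) =
        f , f∈ , R.Acc-unblocks f n (R.Acc-resp (λ i → sym (blocks-f i)) acc)
        where
        open Locate n
        factors : ∀ i → _
        factors i = prod⁻ _ (suc (n i)) (g∈ i)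
        piece : ℕ × ℕ → R.M
        piece (i , o) = proj₁ (factors i) o
        f : ℕ → R.M
        f j = piece (locate j)
        f∈ : ∀ j → f j ∈ᴹ X j
        f∈ j = subst (λ m → f j ∈ᴹ X m) (position-locate j)
                 (proj₁ (proj₂ (factors _)) _ (s≤s (locate-bounded j)))
        blocks-f : ∀ i → R.blocks f n i ≡ g i
        blocks-f i = trans
          (R.prod-cong (suc (n i)) λ { o (s≤s o≤n) → cong piece (locate-position i o o≤n) })
          (proj₂ (proj₂ (factors i)))

    projection : Recognizer A
    projection = record
      { S            = PS.𝒫
      ; M            = PM.𝒫
      ; finite-S     = PS.finite-𝒫
      ; finite-M     = PM.finite-𝒫
      ; leafS        = λ a → PS.⟦ (λ s → ∃[ c ] R.leafS (lift a c) ≡ s) ⟧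
      ; nodeS        = λ a Us → PS.⟦ (λ s → ∃₂ λ c ss →
                         (∀ i → lookup ss i ∈ˢ lookup Us i) × R.nodeS (lift a c) ss ≡ s) ⟧
      ; leafM        = λ a → ⟦ (λ m → ∃[ c ] R.leafM (lift a c) ≡ m) ⟧
      ; rootM        = λ a Us → ⟦ (λ m → ∃₂ λ c ss →
                         (∀ i → lookup ss i ∈ˢ lookup Us i) × R.rootM (lift a c) ss ≡ m) ⟧
      ; _∙_          = _∙_
      ; ε            = ε
      ; monoid       = isMonoid assoc identityˡ identityʳ
      ; Acc          = Acc
      ; Acc-resp     = λ X≗Y (f , f∈ , acc) → f , (λ i → subst (f i ∈ᴹ_) (X≗Y i) (f∈ i)) , acc
      ; Acc-blocks   = λ X n (f , f∈ , acc) →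
          R.blocks f n , (λ i → prod⁺ (suc (n i)) λ o → f∈ _) , R.Acc-blocks f n acc
      ; Acc-unblocks = Acc-unblocks
      }

    private
      module P = Recognizer projection

      _⊗_ : (Point → A) → (Point → Bool) → Point → A′
      (ℓ ⊗ X) x = lift (ℓ x) (X x)

      tabulate∈ : ∀ {n} {f : Fin n → R.S} {g : Fin n → PS.𝒫} → (∀ i → f i ∈ˢ g i) →
                  ∀ i → lookup (tabulate f) i ∈ˢ lookup (tabulate g) i
      tabulate∈ {f = f} {g} f∈g i =
        subst₂ _∈ˢ_ (sym (lookup∘tabulate f i)) (sym (lookup∘tabulate g i)) (f∈g i)

      val∈ : ∀ ℓ X a b → R.val (ℓ ⊗ X) a b ∈ˢ P.val ℓ a b
      val∈ ℓ X a zero    = PS.∈⟦⟧⁺ (X _ , refl)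
      val∈ ℓ X a (suc b) =
        PS.∈⟦⟧⁺ (X _ , _ , tabulate∈ (λ i → val∈ ℓ X (a * k + toℕ i) b) , refl)

      word∈ : ∀ ℓ X i → R.word (ℓ ⊗ X) i ∈ᴹ P.word ℓ i
      word∈ ℓ X zero    = ∈⟦⟧⁺ (X _ , refl)
      word∈ ℓ X (suc b) =
        ∈⟦⟧⁺ (X _ , _ , tabulate∈ (λ j → val∈ ℓ X (suc (toℕ j)) b) , refl)

      -- The chosen bits are returned as a tree, and the conclusion speaks of every `X` that agrees
      -- with it, because a global `X` exists only after bits have been chosen in all slices.
      choose-val : ∀ ℓ a b {s} → s ∈ˢ P.val ℓ a b →
        ∃[ t ] (∀ X → subtree k X a b ≡ t → R.val (ℓ ⊗ X) a b ≡ s)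
      choose-val ℓ a zero s∈ with c , c≡ ← PS.∈⟦⟧⁻ s∈ =
        leaf c , λ X e → trans (cong (λ x → R.leafS (lift (ℓ (a , 0)) (label x))) e) c≡
      choose-val ℓ a (suc b) s∈ with c , ss , ss∈ , s≡ ← PS.∈⟦⟧⁻ s∈ =
        node c (tabulate (proj₁ ∘ sons)) , λ X e →
          let (c≡ , ts≡) = node-injective e in
          trans (cong₂ (λ c ss → R.nodeS (lift (ℓ (a , suc b)) c) ss) c≡
                  (tabulate-lookup λ i → proj₂ (sons i) X (tabulate-injective (λ (i : Fin k) → subtree k X (a * k + toℕ i) b) (proj₁ ∘ sons) ts≡ i)))
                s≡
        where
        sons : ∀ i → _
        sons i = choose-val ℓ (a * k + toℕ i) b (subst (lookup ss i ∈ˢ_)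
          (lookup∘tabulate (λ (i : Fin k) → P.val ℓ (a * k + toℕ i) b) i) (ss∈ i))

      choose-word : ∀ ℓ i {m} → m ∈ᴹ P.word ℓ i →
        ∃[ t ] (∀ X → slice k X i ≡ t → R.word (ℓ ⊗ X) i ≡ m)
      choose-word ℓ zero m∈ with c , c≡ ← ∈⟦⟧⁻ m∈ =
        leaf c , λ X e → trans (cong (λ x → R.leafM (lift (ℓ (0 , 0)) (rootLabel x))) e) c≡
      choose-word ℓ (suc b) m∈ with c , ss , ss∈ , m≡ ← ∈⟦⟧⁻ m∈ =
        root c (tabulate (proj₁ ∘ sons)) , λ X e →
          let (c≡ , ts≡) = root-injective e in
          trans (cong₂ (λ c ss → R.rootM (lift (ℓ (0 , suc b)) c) ss) c≡
                  (tabulate-lookup λ j → proj₂ (sons j) X (tabulate-injective (λ (j : Fin (suc k₂)) → subtree k X (suc (toℕ j)) b) (proj₁ ∘ sons) ts≡ j)))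
                m≡
        where
        sons : ∀ j → _
        sons j = choose-val ℓ (suc (toℕ j)) b (subst (lookup ss j ∈ˢ_)
          (lookup∘tabulate (λ (j : Fin (suc k₂)) → P.val ℓ (suc (toℕ j)) b) j) (ss∈ j))

    projection-Accepts : ∀ ℓ → P.Accepts ℓ ⇔ (∃[ X ] R.Accepts (λ x → lift (ℓ x) (X x)))
    projection-Accepts ℓ = mk⇔
      (λ (f , f∈ , acc) →
        let trees = λ i → choose-word ℓ i (f∈ i)
            -- The slices partition the points, so the bits chosen in each of them combine without
            -- conflict.
            X = unslice (proj₁ ∘ trees)
        in X , R.Acc-resp (λ i → sym (proj₂ (trees i) X (slice-unslice (proj₁ ∘ trees) i))) acc)
      (λ (X , acc) → R.word (ℓ ⊗ X) , word∈ ℓ X , acc)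

  -- A labelling of all points by Q is computed bottom-up by partial functions;
  -- the recognizer accepts iff it is never undefined.
  module Safety {A Q : Set} (finite-Q : Finite Q) (q₀ : Q)
                (leafQ : A → Maybe Q) (nodeQ : A → Vec Q k → Maybe Q) where
    private
      allJust : ∀ {n} → Vec (Maybe Q) n → Maybe (Vec Q n)
      allJust []            = just []
      allJust (nothing ∷ _) = nothing
      allJust (just q ∷ xs) = allJust xs >>= λ qs → just (q ∷ qs)

      allJust⁺ : ∀ {n} (f : Fin n → Maybe Q) (g : Fin n → Q) → (∀ i → f i ≡ just (g i)) →
                 allJust (tabulate f) ≡ just (tabulate g)
      allJust⁺ {zero}  f g e = refl
      allJust⁺ {suc n} f g e rewrite e zero | allJust⁺ (f ∘ suc) (g ∘ suc) (e ∘ suc) = refl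

      allJust⁻ : ∀ {n} (f : Fin n → Maybe Q) {qs} → allJust (tabulate f) ≡ just qs →
                 ∀ i → f i ≡ just (lookup qs i)
      allJust⁻ {suc n} f e    i       with f zero in f0
      allJust⁻ {suc n} f e    i       | just q with allJust (tabulate (f ∘ suc)) in fs
      allJust⁻ {suc n} f refl zero    | just q | just qs = f0
      allJust⁻ {suc n} f refl (suc i) | just q | just qs = allJust⁻ (f ∘ suc) fs i

      nodeS : A → Vec (Maybe Q) k → Maybe Q
      nodeS a xs = allJust xs >>= nodeQ a

      nodeS⁻ : ∀ a (f : Fin k → Maybe Q) {q} → nodeS a (tabulate f) ≡ just q →
               ∃[ qs ] (∀ i → f i ≡ just (lookup qs i)) × nodeQ a qs ≡ just q
      nodeS⁻ a f e with allJust (tabulate f) in eqs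
      ... | just qs = qs , allJust⁻ f eqs , e

      -- Partial functions `Q → Maybe Q` as tables, which makes them finite in number and
      -- extensional. A slice denotes the map from the value of its missing leftmost subtree to its
      -- own value; `_∙_` composes with the left factor first.
      M : Set
      M = Vec (Maybe Q) (card finite-Q)

      fun : (Q → Maybe Q) → M
      fun h = tabulate (h ∘ dec finite-Q)

      apply : M → Maybe Q → Maybe Q
      apply m nothing  = nothing
      apply m (just q) = lookup m (enc finite-Q q)

      apply-fun : ∀ h q → apply (fun h) (just q) ≡ h q
      apply-fun h q = trans (lookup∘tabulate _ (enc finite-Q q)) (cong h (dec-enc finite-Q q))

      M-ext : ∀ {m n} → (∀ q → apply m (just q) ≡ apply n (just q)) → m ≡ n
      M-ext {m} {n} e = begin
        m                   ≡⟨ tabulate∘lookup m ⟨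
        tabulate (lookup m) ≡⟨ tabulate-cong (λ i →
          subst (λ j → lookup m j ≡ lookup n j) (enc-dec finite-Q i) (e (dec finite-Q i))) ⟩
        tabulate (lookup n) ≡⟨ tabulate∘lookup n ⟩
        n                   ∎
        where open ≡-Reasoning

      _∙_ : M → M → M
      m ∙ n = fun λ q → apply n (apply m (just q))

      ε : M
      ε = fun just

      apply-∙ : ∀ m n x → apply (m ∙ n) x ≡ apply n (apply m x)
      apply-∙ m n nothing  = refl
      apply-∙ m n (just q) = apply-fun _ q

      monoid : IsMonoid _≡_ _∙_ ε
      monoid = isMonoid
        (λ x y z → M-ext λ q → begin
          apply ((x ∙ y) ∙ z) (just q)           ≡⟨ apply-∙ (x ∙ y) z (just q) ⟩
          apply z (apply (x ∙ y) (just q))       ≡⟨ cong (apply z) (apply-∙ x y (just q)) ⟩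
          apply z (apply y (apply x (just q)))   ≡⟨ apply-∙ y z (apply x (just q)) ⟨
          apply (y ∙ z) (apply x (just q))       ≡⟨ apply-∙ x (y ∙ z) (just q) ⟨
          apply (x ∙ (y ∙ z)) (just q)           ∎)
        (λ x → M-ext λ q → trans (apply-∙ ε x (just q)) (cong (apply x) (apply-fun just q)))
        (λ x → M-ext λ q → trans (apply-∙ x ε (just q)) (apply-ε (apply x (just q))))
        where
        open ≡-Reasoning
        apply-ε : ∀ x → apply ε x ≡ x
        apply-ε nothing  = refl
        apply-ε (just q) = apply-fun just q

      open Products _∙_ ε

      Alive : (ℕ → M) → ℕ → Set
      Alive f n = ∃[ q ] apply (prod f n) (just q₀) ≡ just q

      -- `nothing` is absorbing, so a computation that dies never revives. Hence being alive at all
      -- block boundaries means being alive everywhere, which is invariance under grouping.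
      Alive-≤ : ∀ f {m n} → m ≤ n → Alive f n → Alive f m
      Alive-≤ f m≤n = go (≤⇒≤′ m≤n)
        where
        go : ∀ {m n} → m ≤′ n → Alive f n → Alive f m
        go ≤′-refl        alive = alive
        go (≤′-step {n} m≤n) (q , e) = go m≤n (previous (apply (prod f n) (just q₀)) refl)
          where
          previous : ∀ x → apply (prod f n) (just q₀) ≡ x → Alive f n
          previous (just q) e′ = q , e′
          previous nothing  e′
            with () ← trans (sym e) (trans (apply-∙ (prod f n) (f n) (just q₀)) (cong (apply (f n)) e′))

    safety : Recognizer A
    safety = record
      { S            = Maybe Q
      ; M            = M
      ; finite-S     = finite-Maybe finite-Q
      ; finite-M     = finite-Vec (finite-Maybe finite-Q) _
      ; leafS        = leafQ
      ; nodeS        = nodeS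
      -- The slice of height 0 has no missing subtree, so it acts as a constant function and any
      -- `q₀` may be fed into the word. In `rootM` the incoming `q` stands for the missing leftmost
      -- son.
      ; leafM        = λ a → fun λ _ → leafQ a
      ; rootM        = λ a xs → fun λ q → nodeS a (just q ∷ xs)
      ; _∙_          = _∙_
      ; ε            = ε
      ; monoid       = monoid
      ; Acc          = λ f → ∀ n → Alive f n
      ; Acc-resp     = λ f≗g alive n →
          subst (λ m → ∃[ q ] apply m (just q₀) ≡ just q) (prod-cong n λ i _ → f≗g i) (alive n)
      ; Acc-blocks   = λ f n alive i →
          subst (λ m → ∃[ q ] apply m (just q₀) ≡ just q) (sym (prod-blocks monoid f n i)) (alive (start n i))
      ; Acc-unblocks = λ f n alive i → Alive-≤ f (i≤start n i)
          (subst (λ m → ∃[ q ] apply m (just q₀) ≡ just q) (prod-blocks monoid f n i) (alive i))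
      }

    private
      module R = Recognizer safety

      -- The tree rooted at 0_(b+1) is the tree rooted at 0_b together with slice `b + 1`, so
      -- composing slices evaluates the trees along the leftmost branch one after the other.
      prod-word : ∀ ℓ b → apply (prod (R.word ℓ) (suc b)) (just q₀) ≡ R.val ℓ 0 b
      prod-word ℓ zero    = trans (apply-∙ ε (R.word ℓ 0) (just q₀))
        (trans (cong (apply (R.word ℓ 0)) (apply-fun just q₀)) (apply-fun _ q₀))
      prod-word ℓ (suc b) = trans (apply-∙ (prod (R.word ℓ) (suc b)) (R.word ℓ (suc b)) (just q₀))
        (trans (cong (apply (R.word ℓ (suc b))) (prod-word ℓ b)) (step (R.val ℓ 0 b)))
        where
        step : ∀ x → apply (R.word ℓ (suc b)) x ≡
                     nodeS (ℓ (0 , suc b)) (x ∷ tabulate λ (j : Fin (suc k₂)) → R.val ℓ (suc (toℕ j)) b)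
        step nothing  = refl
        step (just q) = apply-fun _ q

    Safe : (Point → A) → Set
    Safe ℓ = Σ (Point → Q) λ v → (∀ a → leafQ (ℓ (a , 0)) ≡ just (v (a , 0)))
                  × (∀ a b → nodeQ (ℓ (a , suc b)) (tabulate λ (i : Fin k) → v (a * k + toℕ i , b))
                             ≡ just (v (a , suc b)))

    safety-Accepts : ∀ ℓ → R.Accepts ℓ ⇔ Safe ℓ
    safety-Accepts ℓ = mk⇔ accepts⇒safe safe⇒accepts
      where
      Defined : ℕ → ℕ → Set
      Defined a b = ∃[ q ] R.val ℓ a b ≡ just q

      defined-son : ∀ a b i → Defined a (suc b) → Defined (a * k + toℕ i) b
      defined-son a b i (q , e) = _ , proj₁ (proj₂ (nodeS⁻ (ℓ (a , suc b)) (λ i → R.val ℓ (a * k + toℕ i) b) e)) i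

      accepts⇒safe : R.Accepts ℓ → Safe ℓ
      accepts⇒safe alive = v , (λ a → proj₂ (defined a 0)) , nodes
        where
        leftmost : ∀ b → Defined 0 b
        leftmost b = let (q , e) = alive (suc b) in q , trans (sym (prod-word ℓ b)) e
        -- A value is defined only if those of all sons are, so definedness spreads from the
        -- leftmost branch down to every point.
        defined : ∀ a b → Defined a b
        defined zero    b = leftmost b
        defined (suc a) b = non-leftmost-ind Defined
          (λ b j → defined-son 0 b (suc j) (leftmost (suc b)))
          (λ a b i → defined-son (suc a) b i) a b
        v : Point → Q
        v (a , b) = proj₁ (defined a b)
        nodes : ∀ a b → nodeQ (ℓ (a , suc b)) (tabulate λ (i : Fin k) → v (a * k + toℕ i , b))
                        ≡ just (v (a , suc b))
        nodes a b with qs , qs≡ , e ← nodeS⁻ (ℓ (a , suc b)) (λ i → R.val ℓ (a * k + toℕ i) b) (proj₂ (defined a (suc b))) =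
          trans (cong (nodeQ (ℓ (a , suc b))) (trans (tabulate-cong λ i → just-injective
                  (trans (sym (proj₂ (defined (a * k + toℕ i) b))) (qs≡ i))) (tabulate∘lookup qs))) e

      safe⇒accepts : Safe ℓ → R.Accepts ℓ
      safe⇒accepts (v , leaves , nodes) zero    = q₀ , apply-fun just q₀
      safe⇒accepts (v , leaves , nodes) (suc b) = v (0 , b) , trans (prod-word ℓ b) (val≡ 0 b)
        where
        val≡ : ∀ a b → R.val ℓ a b ≡ just (v (a , b))
        val≡ a zero    = leaves a
        val≡ a (suc b) = trans
          (cong (_>>= nodeQ (ℓ (a , suc b))) (allJust⁺ _ (λ (i : Fin k) → v (a * k + toℕ i , b)) λ i → val≡ (a * k + toℕ i) b)) (nodes a b)

-- Ancestors, and inorder as an irreflexive and connected relation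

module Order (k₂ : ℕ) where
  open Geometry k₂

  parent : Point → Point
  parent (a , b) = a / k , suc b

  parent-child : ∀ {i : Fin k} {x y} → ↓ i x ≡ just y → parent y ≡ x
  parent-child {i} {a , suc b} refl = cong (_, suc b) (quotient-child a i)

  ancestor : ℕ → Point → Point
  ancestor zero    x = x
  ancestor (suc d) x = parent (ancestor d x)

  ancestor-level : ∀ d x → proj₂ (ancestor d x) ≡ d + proj₂ x
  ancestor-level zero    x = refl
  ancestor-level (suc d) x = cong suc (ancestor-level d x)

  InSubtree⇒ancestor : ∀ {x y} → InSubtree k x y → ∃[ d ] ancestor d y ≡ x
  InSubtree⇒ancestor here = 0 , refl
  InSubtree⇒ancestor (below i xz zy) with d , e ← InSubtree⇒ancestor zy =
    suc d , trans (cong parent e) (parent-child xz)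

  InSubtree-level : ∀ {x y} → InSubtree k x y → proj₂ y ≤ proj₂ x
  InSubtree-level {x} {y} xy with d , e ← InSubtree⇒ancestor xy =
    subst (proj₂ y ≤_) (trans (sym (ancestor-level d y)) (cong proj₂ e)) (m≤n+m _ d)

  -- An ancestor of `y` is determined by its level, since `parent` is a function that raises the
  -- level by one.
  InSubtree-disjoint : ∀ {x x′ y} → proj₂ x ≡ proj₂ x′ → InSubtree k x y → InSubtree k x′ y → x ≡ x′
  InSubtree-disjoint {y = y} level xy x′y
    with d , refl ← InSubtree⇒ancestor xy | d′ , refl ← InSubtree⇒ancestor x′y =
    cong (λ d → ancestor d y) (+-cancelʳ-≡ (proj₂ y) d d′
      (trans (sym (ancestor-level d y)) (trans level (ancestor-level d′ y))))

  InSubtree-trans : ∀ {x y z} → InSubtree k x y → InSubtree k y z → InSubtree k x z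
  InSubtree-trans here            yz = yz
  InSubtree-trans (below i xw wy) yz = below i xw (InSubtree-trans wy yz)

  leftmost-InSubtree : ∀ {b c} → b ≤ c → InSubtree k (0 , c) (0 , b)
  leftmost-InSubtree b≤c = go (≤⇒≤′ b≤c)
    where
    go : ∀ {b c} → b ≤′ c → InSubtree k (0 , c) (0 , b)
    go ≤′-refl       = here
    go (≤′-step b≤c) = below zero refl (go b≤c)

  below-leftmost : ∀ x → ∃[ c ] InSubtree k (0 , c) x
  below-leftmost (zero  , b) = b , here
  below-leftmost (suc a , b) = non-leftmost-ind (λ a b → ∃[ c ] InSubtree k (0 , c) (a , b))
    (λ b j → suc b , below (suc j) refl here)
    (λ a b i (c , sub) → c , InSubtree-trans sub (below i refl here)) a b

  Inorder-irrefl : ∀ {x} → ¬ Inorder k x x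
  Inorder-irrefl {a , suc b} (left-root  i _ refl zx) = <-irrefl refl (InSubtree-level zx)
  Inorder-irrefl {a , suc b} (root-right i _ refl zx) = <-irrefl refl (InSubtree-level zx)
  Inorder-irrefl (subtrees {r = a , suc b} i j i<j refl ux refl vx) =
    <-irrefl (cong toℕ (proj₂ (child-injective {a} {a} {i} {j}
      (cong proj₁ (InSubtree-disjoint refl ux vx))))) i<j

  Inorder-connex : ∀ {r x y} → InSubtree k r x → InSubtree k r y →
                   x ≡ y ⊎ Inorder k x y ⊎ Inorder k y x
  Inorder-connex here here = inj₁ refl
  Inorder-connex here (below zero    rz zy) = inj₂ (inj₂ (left-root zero refl rz zy))
  Inorder-connex here (below (suc i) rz zy) = inj₂ (inj₁ (root-right (suc i) (s≤s z≤n) rz zy))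
  Inorder-connex (below zero    rz zx) here = inj₂ (inj₁ (left-root zero refl rz zx))
  Inorder-connex (below (suc i) rz zx) here = inj₂ (inj₂ (root-right (suc i) (s≤s z≤n) rz zx))
  Inorder-connex (below i ru ux) (below j rv vy) with <ᶠ-cmp i j
  ... | tri< i<j _ _ = inj₂ (inj₁ (subtrees i j i<j ru ux rv vy))
  ... | tri> _ _ j<i = inj₂ (inj₂ (subtrees j i j<i rv vy ru ux))
  ... | tri≈ _ refl _ with refl ← trans (sym ru) rv = Inorder-connex ux vy

  -- Any two points lie below a common leftmost point. The order is decided at the node where the
  -- two downward paths part.
  Inorder-total : ∀ x y → x ≡ y ⊎ Inorder k x y ⊎ Inorder k y x
  Inorder-total x y with c , cx ← below-leftmost x | d , dy ← below-leftmost y =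
    Inorder-connex (InSubtree-trans (leftmost-InSubtree (m≤m⊔n c d)) cx)
                   (InSubtree-trans (leftmost-InSubtree (m≤n⊔m c d)) dy)

  leftmost-Inorder : ∀ {b c} → b < c → Inorder k (0 , b) (0 , c)
  leftmost-Inorder (s≤s b≤c) = left-root zero refl refl (leftmost-InSubtree b≤c)

  ancestor-leftmost : ∀ d b → proj₁ (ancestor d (0 , b)) ≡ 0
  ancestor-leftmost zero    b = refl
  ancestor-leftmost (suc d) b rewrite ancestor-leftmost d b = refl

  InSubtree-leftmost : ∀ {a b c} → InSubtree k (a , b) (0 , c) → a ≡ 0
  InSubtree-leftmost {c = c} sub with d , e ← InSubtree⇒ancestor sub =
    trans (sym (cong proj₁ e)) (ancestor-leftmost d c)

  -- Only `left-root` can relate two leftmost points: the other constructors place the larger point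
  -- below a son that is not the leftmost, whereas all ancestors of a leftmost point are leftmost.
  Inorder-leftmost : ∀ {b c} → Inorder k (0 , b) (0 , c) → b ≤ c
  Inorder-leftmost {c = suc c} (left-root i _ refl sub) = m≤n⇒m≤1+n (InSubtree-level sub)
  Inorder-leftmost {suc b} (root-right i 1≤i refl sub) =
    ⊥-elim (<-irrefl refl (≤-trans 1≤i (≤-reflexive (InSubtree-leftmost sub))))
  Inorder-leftmost (subtrees {r = a , suc _} i j i<j _ _ refl sub) =
    ⊥-elim (<-irrefl refl (≤-trans (≤-trans (s≤s z≤n) i<j)
      (≤-trans (m≤n+m (toℕ j) (a * k)) (≤-reflexive (InSubtree-leftmost sub)))))

-- From formulas to recognizers

module Translation (em : ExcludedMiddle 0ℓ) (k₂ : ℕ) where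
  open Geometry k₂
  open Order k₂
  open Recognizers em k₂

  unless : ∀ {Bad Q : Set} → Dec Bad → Q → Maybe Q
  unless (yes _) _ = nothing
  unless (no _)  q = just q

  unless⁺ : ∀ {Bad Q : Set} (Bad? : Dec Bad) {q q′ : Q} → ¬ Bad → q ≡ q′ → unless Bad? q ≡ just q′
  unless⁺ (yes b) ¬b _ = ⊥-elim (¬b b)
  unless⁺ (no _)  _  e = cong just e

  unless⁻ : ∀ {Bad Q : Set} (Bad? : Dec Bad) {q q′ : Q} → unless Bad? q ≡ just q′ → ¬ Bad × q ≡ q′
  unless⁻ (no ¬b) e = ¬b , just-injective e

  Recognizes : ∀ {A} → Recognizer A → ((Point → A) → Set) → Set
  Recognizes {A} R P = ∀ ℓ → Recognizer.Accepts R ℓ ⇔ P ℓ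

  Recognizable : ∀ {A} → ((Point → A) → Set) → Set₁
  Recognizable {A} P = Σ (Recognizer A) λ R → Recognizes R P

  recognizable-cong : ∀ {A} {P P′ : (Point → A) → Set} → (∀ ℓ → P ℓ ⇔ P′ ℓ) →
                      Recognizable P → Recognizable P′
  recognizable-cong P⇔P′ (R , rec) =
    R , λ ℓ → mk⇔ (to (P⇔P′ ℓ) ∘ to (rec ℓ)) (from (rec ℓ) ∘ from (P⇔P′ ℓ))

  recognizable-¬ : ∀ {A} {P : (Point → A) → Set} → Recognizable P → Recognizable (λ ℓ → ¬ P ℓ)
  recognizable-¬ (R , rec) = complement R , λ ℓ →
    mk⇔ (λ acc → to (complement-Accepts R ℓ) acc ∘ from (rec ℓ))
        (λ ¬p → from (complement-Accepts R ℓ) (¬p ∘ to (rec ℓ)))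

  recognizable-× : ∀ {A} {P P′ : (Point → A) → Set} → Recognizable P → Recognizable P′ →
                   Recognizable (λ ℓ → P ℓ × P′ ℓ)
  recognizable-× (R , rec) (R′ , rec′) = intersection , λ ℓ →
    mk⇔ (λ acc → let (acc₁ , acc₂) = to (intersection-Accepts ℓ) acc in
                  to (rec ℓ) acc₁ , to (rec′ ℓ) acc₂)
        (λ (p , p′) → from (intersection-Accepts ℓ) (from (rec ℓ) p , from (rec′ ℓ) p′))
    where open Intersection R R′

  recognizable-∃ : ∀ {A A′} (lift : A → Bool → A′) {P : (Point → A′) → Set} → Recognizable P →
                   Recognizable (λ ℓ → ∃[ X ] P (λ x → lift (ℓ x) (X x)))
  recognizable-∃ lift (R , rec) = projection , λ ℓ →
    mk⇔ (λ acc → let (X , acc′) = to (projection-Accepts ℓ) acc in X , to (rec _) acc′)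
        (λ (X , p) → from (projection-Accepts ℓ) (X , from (rec _) p))
    where open Projection lift R

  module _ {A : Set} (c : A → Bool) where
    private
      open module S = Safety finite-⊤ tt
        (λ a → unless (em {T (c a)}) tt) (λ a _ → unless (em {T (c a)}) tt)

    recognizable-nowhere : Recognizable (λ ℓ → ∀ x → ¬ T (c (ℓ x)))
    recognizable-nowhere = safety , λ ℓ → mk⇔
      (λ acc → nowhere ℓ (to (safety-Accepts ℓ) acc))
      (λ ¬c → from (safety-Accepts ℓ)
        ((λ _ → tt) , (λ a → unless⁺ em (¬c _) refl) , (λ a b → unless⁺ em (¬c _) refl)))
      where
      nowhere : ∀ ℓ → Safe ℓ → ∀ x → ¬ T (c (ℓ x))
      nowhere ℓ (v , leaves , nodes) (a , zero)  = proj₁ (unless⁻ em (leaves a))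
      nowhere ℓ (v , leaves , nodes) (a , suc b) = proj₁ (unless⁻ em (nodes a b))

    recognizable-somewhere : Recognizable (λ ℓ → ∃[ x ] T (c (ℓ x)))
    recognizable-somewhere = recognizable-cong
      (λ ℓ → mk⇔ (λ ¬∀ → decidable-stable em λ ¬∃ → ¬∀ λ x p → ¬∃ (x , p)) (λ (x , p) ¬c → ¬c x p))
      (recognizable-¬ recognizable-nowhere)

  -- On tracks that mark single points a pattern is just the atomic formula for `R`, see `pattern⇔`.
  -- For the projections and the order, absence of the pattern is a safety condition, so the pattern
  -- itself is recognized by a complement.
  Pattern : ∀ {A : Set} → (Point → Point → Set) → (c d : A → Bool) → (Point → A) → Set
  Pattern R c d ℓ = ∃₂ λ x y → R x y × T (c (ℓ x)) × T (d (ℓ y))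

  module _ {A : Set} (c d : A → Bool) where
    module _ (i : Fin k) where
      private
        -- The state of a point is its `d`-label, which makes it visible to the parent; the
        -- evaluation fails at a `c`-labelled parent whose son `i` has it.
        open module S = Safety finite-Bool false
          (λ a → just (d a)) (λ a bs → unless (em {T (c a) × T (lookup bs i)}) (d a))

        label-d : ∀ {ℓ} ((v , _) : Safe ℓ) x → d (ℓ x) ≡ v x
        label-d (v , leaves , nodes) (a , zero)  = just-injective (leaves a)
        label-d (v , leaves , nodes) (a , suc b) = proj₂ (unless⁻ em (nodes a b))

      recognizable-proj : Recognizable (Pattern (λ x y → ↓ i x ≡ just y) c d)
      recognizable-proj = recognizable-cong (λ ℓ → mk⇔ (decidable-stable em) (λ p ¬p → ¬p p))
        (recognizable-¬ (safety , λ ℓ → mk⇔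
          (λ acc → unmatched ℓ (to (safety-Accepts ℓ) acc))
          (λ ¬p → from (safety-Accepts ℓ) (d ∘ ℓ , (λ _ → refl) , λ a b → unless⁺ em
            (λ (cx , dy) → ¬p ((a , suc b) , (a * k + toℕ i , b) , refl , cx ,
              subst T (lookup∘tabulate (λ (i : Fin k) → d (ℓ (a * k + toℕ i , b))) i) dy)) refl))))
        where
        unmatched : ∀ ℓ → Safe ℓ → ¬ Pattern (λ x y → ↓ i x ≡ just y) c d ℓ
        unmatched ℓ safe@(v , _ , nodes) ((a , suc b) , _ , refl , cx , dy) =
          proj₁ (unless⁻ em (nodes a b))
            (cx , subst T (sym (trans (lookup∘tabulate (λ (i : Fin k) → v (a * k + toℕ i , b)) i)
                                    (sym (label-d {ℓ} safe _)))) dy)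

    private
      -- A state tells whether `c` and whether `d` occurs in the subtree. The disjuncts are the
      -- constructors `left-root`, `root-right` and `subtrees` of `Inorder`, detected at the node
      -- where the two points separate.
      Bad : A → Vec (Bool × Bool) k → Set
      Bad a qs = T (proj₁ (lookup qs zero)) × T (d a)
               ⊎ T (c a) × (∃[ j ] 1 ≤ toℕ j × T (proj₂ (lookup qs j)))
               ⊎ (∃₂ λ i j → toℕ i < toℕ j × T (proj₁ (lookup qs i)) × T (proj₂ (lookup qs j)))

      Occurs : (A → Bool) → (Bool × Bool → Bool) → A → Vec (Bool × Bool) k → Set
      Occurs e π a qs = T (e a) ⊎ (∃[ i ] T (π (lookup qs i)))

      open module S = Safety (finite-× finite-Bool finite-Bool) (false , false)
        (λ a → just (c a , d a))
        (λ a qs → unless (em {Bad a qs})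
          (does (em {Occurs c proj₁ a qs}) , does (em {Occurs d proj₂ a qs})))

      module _ (ℓ : Point → A) where
        OccursBelow : (A → Bool) → Point → Set
        OccursBelow e x = ∃[ y ] InSubtree k x y × T (e (ℓ y))

        leaf-occurs : ∀ {e a} → OccursBelow e (a , 0) → T (e (ℓ (a , 0)))
        leaf-occurs (_ , here , ey) = ey

        module _ (safe : Safe ℓ) where
          private
            v = proj₁ safe
            leaves = proj₁ (proj₂ safe)
            nodes = proj₂ (proj₂ safe)

            sons : ∀ a b → Vec (Bool × Bool) k
            sons a b = tabulate λ (i : Fin k) → v (a * k + toℕ i , b)

            son≡ : ∀ a b i → lookup (sons a b) i ≡ v (a * k + toℕ i , b)
            son≡ a b = lookup∘tabulate λ (i : Fin k) → v (a * k + toℕ i , b)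

          marked : ∀ (e : A → Bool) (π : Bool × Bool → Bool) →
            (∀ a → e (ℓ (a , 0)) ≡ π (v (a , 0))) →
            (∀ a b → does (em {Occurs e π (ℓ (a , suc b)) (sons a b)}) ≡ π (v (a , suc b))) →
            ∀ {x y} → InSubtree k x y → T (e (ℓ y)) → T (π (v x))
          marked e π leaf≡ node≡ {a , zero}  here ey = subst T (leaf≡ a) ey
          marked e π leaf≡ node≡ {a , suc b} here ey = subst T (node≡ a b) (does⁺ em (inj₁ ey))
          marked e π leaf≡ node≡ {a , suc b} (below i refl zy) ey = subst T (node≡ a b)
            (does⁺ em (inj₂ (i , subst (T ∘ π) (sym (son≡ a b i)) (marked e π leaf≡ node≡ zy ey))))

          marked-c : ∀ {x y} → InSubtree k x y → T (c (ℓ y)) → T (proj₁ (v x))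
          marked-c = marked c proj₁ (λ a → cong proj₁ (just-injective (leaves a)))
            (λ a b → cong proj₁ (proj₂ (unless⁻ em (nodes a b))))

          marked-d : ∀ {x y} → InSubtree k x y → T (d (ℓ y)) → T (proj₂ (v x))
          marked-d = marked d proj₂ (λ a → cong proj₂ (just-injective (leaves a)))
            (λ a b → cong proj₂ (proj₂ (unless⁻ em (nodes a b))))

          unmatched : ¬ Pattern (Inorder k) c d ℓ
          unmatched (x , (a , suc b) , left-root zero refl refl zx , cx , dy) =
            proj₁ (unless⁻ em (nodes a b)) (inj₁ (marked-c zx cx , dy))
          unmatched ((a , suc b) , y , root-right i 1≤i refl zy , cx , dy) =
            proj₁ (unless⁻ em (nodes a b)) (inj₂ (inj₁
              (cx , i , 1≤i , subst (T ∘ proj₂) (sym (son≡ a b i)) (marked-d zy dy))))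
          unmatched (x , y , subtrees {r = a , suc b} i j i<j refl ux refl vy , cx , dy) =
            proj₁ (unless⁻ em (nodes a b)) (inj₂ (inj₂
              (i , j , i<j , subst (T ∘ proj₁) (sym (son≡ a b i)) (marked-c ux cx)
                           , subst (T ∘ proj₂) (sym (son≡ a b j)) (marked-d vy dy))))

        module _ (¬p : ¬ Pattern (Inorder k) c d ℓ) where
          private
            v : Point → Bool × Bool
            v x = does (em {OccursBelow c x}) , does (em {OccursBelow d x})

            sons : ∀ a b → Vec (Bool × Bool) k
            sons a b = tabulate λ (i : Fin k) → v (a * k + toℕ i , b)

            module _ (a b : ℕ) where
              son⁻ : ∀ (e : A → Bool) (π : Bool × Bool → Bool) →
                (∀ x → π (v x) ≡ does (em {OccursBelow e x})) →
                ∀ i → T (π (lookup (sons a b) i)) → OccursBelow e (a * k + toℕ i , b)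
              son⁻ e π e≡ i t = does⁻ em (subst T (e≡ _)
                (subst (T ∘ π) (lookup∘tabulate (λ (i : Fin k) → v (a * k + toℕ i , b)) i) t))

              occurs⇔ : ∀ (e : A → Bool) (π : Bool × Bool → Bool) →
                (∀ x → π (v x) ≡ does (em {OccursBelow e x})) →
                does (em {Occurs e π (ℓ (a , suc b)) (sons a b)}) ≡
                does (em {OccursBelow e (a , suc b)})
              occurs⇔ e π e≡ = does-⇔ (mk⇔ up down) em em
                where
                up : Occurs e π (ℓ (a , suc b)) (sons a b) → OccursBelow e (a , suc b)
                up (inj₁ ex)      = _ , here , ex
                up (inj₂ (i , t)) with y , zy , ey ← son⁻ e π e≡ i t = y , below i refl zy , ey
                down : OccursBelow e (a , suc b) → Occurs e π (ℓ (a , suc b)) (sons a b)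
                down (_ , here , ex) = inj₁ ex
                down (y , below i refl zy , ey) = inj₂ (i , subst (T ∘ π)
                  (sym (lookup∘tabulate (λ (i : Fin k) → v (a * k + toℕ i , b)) i))
                  (subst T (sym (e≡ _)) (does⁺ em (y , zy , ey))))

              ¬bad : ¬ Bad (ℓ (a , suc b)) (sons a b)
              ¬bad (inj₁ (t , dx)) with y , zy , cy ← son⁻ c proj₁ (λ _ → refl) zero t =
                ¬p (y , (a , suc b) , left-root zero refl refl zy , cy , dx)
              ¬bad (inj₂ (inj₁ (cx , j , 1≤j , t))) with y , zy , dy ← son⁻ d proj₂ (λ _ → refl) j t =
                ¬p ((a , suc b) , y , root-right j 1≤j refl zy , cx , dy)
              ¬bad (inj₂ (inj₂ (i , j , i<j , t , t′)))
                with x , ux , cx ← son⁻ c proj₁ (λ _ → refl) i t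
                   | y , vy , dy ← son⁻ d proj₂ (λ _ → refl) j t′ =
                ¬p (x , y , subtrees {r = a , suc b} i j i<j refl ux refl vy , cx , dy)

          matchless-safe : Safe ℓ
          matchless-safe = v ,
            (λ a → cong just (cong₂ _,_ (leaf-value c a) (leaf-value d a))) ,
            (λ a b → unless⁺ em (¬bad a b)
              (cong₂ _,_ (occurs⇔ a b c proj₁ (λ _ → refl)) (occurs⇔ a b d proj₂ (λ _ → refl))))
            where
            leaf-value : ∀ e a → e (ℓ (a , 0)) ≡ does (em {OccursBelow e (a , 0)})
            leaf-value e a with e (ℓ (a , 0)) in ea | em {OccursBelow e (a , 0)}
            ... | true  | yes _ = refl
            ... | false | no _  = refl
            ... | true  | no ¬o = ⊥-elim (¬o (_ , here , subst T (sym ea) tt))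
            ... | false | yes o = ⊥-elim (subst T ea (leaf-occurs {e} o))

    recognizable-less : Recognizable (Pattern (Inorder k) c d)
    recognizable-less = recognizable-cong (λ ℓ → mk⇔ (decidable-stable em) (λ p ¬p → ¬p p))
      (recognizable-¬ (safety , λ ℓ → mk⇔
        (λ acc → unmatched ℓ (to (safety-Accepts ℓ) acc))
        (λ ¬p → from (safety-Accepts ℓ) (matchless-safe ℓ ¬p))))

  Singleton : (Point → Bool) → Set
  Singleton X = ∃[ x ] ∀ y → T (X y) ⇔ x ≡ y

  -- As `Inorder` is irreflexive and connects distinct points, a set has at most one element iff it
  -- contains no two points in increasing order.
  recognizable-singleton : ∀ {A : Set} (c : A → Bool) → Recognizable (λ ℓ → Singleton (c ∘ ℓ))
  recognizable-singleton c = recognizable-cong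
    (λ ℓ → mk⇔ (λ ((x , cx) , ¬2) → x , λ y → mk⇔ (λ cy → unique ℓ ¬2 cx cy) λ { refl → cx })
               (λ (x , c⇔) → (x , from (c⇔ x) refl) , λ (y , z , y<z , cy , cz) →
                 Inorder-irrefl (subst₂ (Inorder k) (sym (to (c⇔ y) cy)) (sym (to (c⇔ z) cz)) y<z)))
    (recognizable-× (recognizable-somewhere c) (recognizable-¬ (recognizable-less c c)))
    where
    unique : ∀ ℓ → ¬ Pattern (Inorder k) c c ℓ → ∀ {x y} → T (c (ℓ x)) → T (c (ℓ y)) → x ≡ y
    unique ℓ ¬2 {x} {y} cx cy with Inorder-total x y
    ... | inj₁ x≡y        = x≡y
    ... | inj₂ (inj₁ x<y) = ⊥-elim (¬2 (x , y , x<y , cx , cy))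
    ... | inj₂ (inj₂ y<x) = ⊥-elim (¬2 (y , x , y<x , cy , cx))

  Letter : (n m p : ℕ) → Set
  Letter n m p = Vec Bool n × Vec Bool m × Vec Bool p

  valuation : ∀ {n m p} → UULS k p → Vec Point n → Vec PointSet m → Point → Letter n m p
  valuation t ρ θ x = map (λ y → does (em {y ≡ x})) ρ , map (λ X → X x) θ , labels t x

  module _ {n m p : ℕ} where
    isPoint : Fin n → Letter n m p → Bool
    isPoint i (u , _ , _) = lookup u i

    inTrack : Fin m → Letter n m p → Bool
    inTrack j (_ , v , _) = lookup v j

    hasPred : Fin p → Letter n m p → Bool
    hasPred P (_ , _ , w) = lookup w P

    module _ (t : UULS k p) (ρ : Vec Point n) (θ : Vec PointSet m) where
      isPoint⁺ : ∀ i {x} → lookup ρ i ≡ x → T (isPoint i (valuation t ρ θ x))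
      isPoint⁺ i e = subst T (sym (lookup-map i _ ρ)) (does⁺ em e)

      isPoint⁻ : ∀ i {x} → T (isPoint i (valuation t ρ θ x)) → lookup ρ i ≡ x
      isPoint⁻ i e = does⁻ em (subst T (lookup-map i _ ρ) e)

      pattern⇔ : ∀ R i j → Pattern R (isPoint i) (isPoint j) (valuation t ρ θ) ⇔ R (lookup ρ i) (lookup ρ j)
      pattern⇔ R i j = mk⇔
        (λ (x , y , xRy , ix , jy) → subst₂ R (sym (isPoint⁻ i ix)) (sym (isPoint⁻ j jy)) xRy)
        (λ xRy → _ , _ , xRy , isPoint⁺ i refl , isPoint⁺ j refl)

      somewhere⇔ : ∀ i (e : Letter n m p → Bool) →
        (∃[ x ] T (isPoint i (valuation t ρ θ x) ∧ e (valuation t ρ θ x))) ⇔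
        T (e (valuation t ρ θ (lookup ρ i)))
      somewhere⇔ i e = mk⇔
        (λ (x , both) → let (ix , ex) = to T-∧ both in
          subst (λ x → T (e (valuation t ρ θ x))) (sym (isPoint⁻ i ix)) ex)
        (λ ex → lookup ρ i , from T-∧ (isPoint⁺ i refl , ex))

  -- Correctness is demanded only on labellings that come from assignments, where each track of an
  -- individual variable marks exactly one point. The case of `ex₁` must therefore enforce this for
  -- the track that it projects away.
  MSO-Recognizable : ∀ {n m p} → Formula k p n m → Set₁
  MSO-Recognizable {n} {m} {p} φ = Σ (Recognizer (Letter n m p)) λ R →
    ∀ t ρ θ → Recognizer.Accepts R (valuation t ρ θ) ⇔ Sat t ρ θ φ

  satisfies : ∀ {n m p} (φ : Formula k p n m) {P : (Point → Letter n m p) → Set} →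
    Recognizable P → (∀ t ρ θ → P (valuation t ρ θ) ⇔ Sat t ρ θ φ) → MSO-Recognizable φ
  satisfies _ (R , rec) P⇔ = R , λ t ρ θ →
    mk⇔ (to (P⇔ t ρ θ) ∘ to (rec _)) (from (rec _) ∘ from (P⇔ t ρ θ))

  accepted : ∀ {A} (R : Recognizer A) → Recognizable (Recognizer.Accepts R)
  accepted R = R , λ _ → mk⇔ id id

  translate : ∀ {n m p} (φ : Formula k p n m) → MSO-Recognizable φ
  translate φ₀@(eq x y) = satisfies φ₀ (recognizable-somewhere λ a → isPoint x a ∧ isPoint y a) λ t ρ θ →
    mk⇔ (λ occ → sym (isPoint⁻ t ρ θ y (to (somewhere⇔ t ρ θ x (isPoint y)) occ)))
        (λ e → from (somewhere⇔ t ρ θ x (isPoint y)) (isPoint⁺ t ρ θ y (sym e)))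
  translate φ₀@(less x y) = satisfies φ₀ (recognizable-less (isPoint x) (isPoint y)) λ t ρ θ →
    pattern⇔ t ρ θ (Inorder k) x y
  translate φ₀@(proj i x y) = satisfies φ₀ (recognizable-proj (isPoint x) (isPoint y) i) λ t ρ θ →
    pattern⇔ t ρ θ (λ x y → ↓ i x ≡ just y) x y
  translate φ₀@(inSet x X) = satisfies φ₀ (recognizable-somewhere λ a → isPoint x a ∧ inTrack X a) λ t ρ θ →
    mk⇔ (λ occ → subst T (lookup-map X _ θ) (to (somewhere⇔ t ρ θ x (inTrack X)) occ))
        (λ e → from (somewhere⇔ t ρ θ x (inTrack X)) (subst T (sym (lookup-map X _ θ)) e))
  translate φ₀@(pred x P) = satisfies φ₀ (recognizable-somewhere λ a → isPoint x a ∧ hasPred P a) λ t ρ θ →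
    mk⇔ (λ occ → subst T (lookup∘tabulate _ P) (to (somewhere⇔ t ρ θ x (hasPred P)) occ))
        (λ e → from (somewhere⇔ t ρ θ x (hasPred P)) (subst T (sym (lookup∘tabulate _ P)) e))
  translate φ₀@(neg φ) with R , rec ← translate φ =
    satisfies φ₀ (recognizable-¬ (accepted R)) λ t ρ θ →
      mk⇔ (_∘ from (rec t ρ θ)) (_∘ to (rec t ρ θ))
  translate φ₀@(and φ ψ) with R , rec ← translate φ | R′ , rec′ ← translate ψ =
    satisfies φ₀ (recognizable-× (accepted R) (accepted R′)) λ t ρ θ →
      mk⇔ (λ (p , p′) → to (rec t ρ θ) p , to (rec′ t ρ θ) p′)
          (λ (s , s′) → from (rec t ρ θ) s , from (rec′ t ρ θ) s′)
  translate φ₀@(ex₁ φ) with R , rec ← translate φ =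
    satisfies φ₀ (recognizable-∃ (λ (u , v , w) b → b ∷ u , v , w)
                (recognizable-× (recognizable-singleton (isPoint zero)) (accepted R))) λ t ρ θ →
      -- The guessed singleton equals the track of `a` only pointwise, hence the transport along
      -- `Accepts-cong`.
      mk⇔ (λ (X , (a , X⇔) , acc) → a , to (rec t (a ∷ ρ) θ) (Recognizer.Accepts-cong R
             (λ x → cong (λ b → b ∷ map (λ y → does (em {y ≡ x})) ρ , map (λ Y → Y x) θ , labels t x) (T⇔does (X⇔ x))) acc))
          (λ (a , sat) → (λ x → does (em {a ≡ x})) , (a , λ x → mk⇔ (does⁻ em) (does⁺ em)) ,
             from (rec t (a ∷ ρ) θ) sat)
    where
    T⇔does : ∀ {b} {P : Set} → T b ⇔ P → b ≡ does (em {P})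
    T⇔does {b} {P} b⇔ with b | em {P}
    ... | true  | yes _ = refl
    ... | false | no _  = refl
    ... | true  | no ¬p = ⊥-elim (¬p (to b⇔ tt))
    ... | false | yes p = ⊥-elim (from b⇔ p)
  translate φ₀@(ex₂ φ) with R , rec ← translate φ =
    satisfies φ₀ (recognizable-∃ (λ (u , v , w) b → u , b ∷ v , w) (accepted R)) λ t ρ θ →
      mk⇔ (λ (X , acc) → X , to (rec t ρ (X ∷ θ)) acc) (λ (X , sat) → X , from (rec t ρ (X ∷ θ)) sat)

-- Ramsey's theorem for pairs

module Ramsey (em : ExcludedMiddle 0ℓ) where
  Infinite : (ℕ → Set) → Set
  Infinite J = ∀ m → ∃[ i ] m ≤ i × J i

  upper-bound : ∀ {n} (m : Fin n → ℕ) → ∃[ M ] ∀ i → m i ≤ M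
  upper-bound {zero}  m = 0 , λ ()
  upper-bound {suc n} m with M , m≤M ← upper-bound (m ∘ suc) =
    m zero + M , λ { zero → m≤m+n _ _ ; (suc i) → ≤-trans (m≤M i) (m≤n+m _ _) }

  InfiniteSet : Set₁
  InfiniteSet = Σ (ℕ → Set) Infinite

  opaque
    -- If every colour stopped occurring, the finitely many bounds would have a common upper bound,
    -- beyond which `J` still has an element.
    pigeonhole : ∀ {n} {J : ℕ → Set} → Infinite J → (c : ℕ → Fin n) → ∃[ e ] Infinite (λ i → J i × c i ≡ e)
    pigeonhole {n} {J} inf c with em {∃[ e ] Infinite (λ i → J i × c i ≡ e)}
    ... | yes found = found
    ... | no ¬found = ⊥-elim contradiction
      where
      bounded : ∀ e → ∃[ m ] ¬ (∃[ i ] m ≤ i × J i × c i ≡ e)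
      bounded e with em {∃[ m ] ¬ (∃[ i ] m ≤ i × J i × c i ≡ e)}
      ... | yes b = b
      ... | no ¬b = ⊥-elim (¬found (e , λ m → occurs m em))
        where
        occurs : ∀ m → Dec (∃[ i ] m ≤ i × J i × c i ≡ e) → ∃[ i ] m ≤ i × J i × c i ≡ e
        occurs m (yes o) = o
        occurs m (no ¬o) = ⊥-elim (¬b (m , ¬o))
      contradiction : ⊥
      contradiction with M , m≤M ← upper-bound (proj₁ ∘ bounded) with i , M≤i , Ji ← inf M =
        proj₂ (bounded (c i)) (i , ≤-trans (m≤M (c i)) M≤i , Ji , refl)

  opaque
    increasing : ∀ {p : ℕ → ℕ} → (∀ i → p i < p (suc i)) → ∀ {i j} → i < j → p i < p j
    increasing {p} p< i<j = go (≤⇒≤′ i<j)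
      where
      go : ∀ {i j} → suc i ≤′ j → p i < p j
      go ≤′-refl       = p< _
      go (≤′-step i<j) = <-trans (go i<j) (p< _)

    enumerate : ∀ {J : ℕ → Set} → Infinite J → Σ (ℕ → ℕ) λ h → (∀ i → J (h i)) × (∀ i → h i < h (suc i))
    enumerate {J} inf = h , h∈ , λ i → proj₁ (proj₂ (inf (suc (h i))))
      where
      h : ℕ → ℕ
      h zero    = proj₁ (inf 0)
      h (suc i) = proj₁ (inf (suc (h i)))
      h∈ : ∀ i → J (h i)
      h∈ zero    = proj₂ (proj₂ (inf 0))
      h∈ (suc i) = proj₂ (proj₂ (inf (suc (h i))))

  opaque
    -- Infinite sets are shrunk so that the first element of each has one colour with everything in
    -- the next. The colour of a pair of first elements then depends on the smaller one only, and a
    -- last pigeonhole makes it constant.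
    ramsey : ∀ {n} (col : ℕ → ℕ → Fin n) →
      Σ (ℕ → ℕ) λ h → Σ (Fin n) λ e → (∀ i → h i < h (suc i)) × (∀ {i j} → i < j → col (h i) (h j) ≡ e)
    ramsey {n} col = elem ∘ h , e , (λ i → proj₁ (later (h< i))) ,
                     λ {i} i<j → trans (proj₂ (later (increasing h< i<j))) (proj₂ (h∈ i))
      where
      first : InfiniteSet → ℕ
      first (J , inf) = proj₁ (inf 0)

      refine : (st : InfiniteSet) → ∃[ c ] Infinite (λ j → (proj₁ st j × first st < j) × col (first st) j ≡ c)
      refine (J , inf) = pigeonhole
        (λ m → let (j , m≤j , Jj) = inf (m + suc (first (J , inf))) in
          j , ≤-trans (m≤m+n _ _) m≤j , Jj , ≤-trans (m≤n+m _ m) m≤j)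
        (col (first (J , inf)))

      states : ℕ → InfiniteSet
      states zero    = (λ _ → ⊤) , λ m → m , ≤-refl , tt
      states (suc i) = _ , proj₂ (refine (states i))

      elem : ℕ → ℕ
      elem i = first (states i)

      colour : ℕ → Fin n
      colour i = proj₁ (refine (states i))

      member : ∀ {i j} → suc i ≤′ j → ∀ {x} → proj₁ (states j) x → elem i < x × col (elem i) x ≡ colour i
      member ≤′-refl       ((_ , lt) , c≡) = lt , c≡
      member (≤′-step i<j) ((Jx , _) , _)  = member i<j Jx

      later : ∀ {i j} → i < j → elem i < elem j × col (elem i) (elem j) ≡ colour i
      later {j = j} i<j = member (≤⇒≤′ i<j) (proj₂ (proj₂ (proj₂ (states j) 0)))

      colours : ∃[ e ] Infinite (λ i → ⊤ × colour i ≡ e)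
      colours = pigeonhole (λ m → m , ≤-refl , tt) colour

      e : Fin n
      e = proj₁ colours
      enumeration : Σ (ℕ → ℕ) λ h → (∀ i → ⊤ × colour (h i) ≡ e) × (∀ i → h i < h (suc i))
      enumeration = enumerate (proj₂ colours)
      h : ℕ → ℕ
      h = proj₁ enumeration
      h∈ : ∀ i → ⊤ × colour (h i) ≡ e
      h∈ = proj₁ (proj₂ enumeration)
      h< : ∀ i → h i < h (suc i)
      h< = proj₂ (proj₂ enumeration)

-- Block 0 ends where `p 0` begins, so `1 ≤ p 0` keeps it nonempty; lengths are stored minus one.
grouping : (p : ℕ → ℕ) → 1 ≤ p 0 → (∀ i → p i < p (suc i)) → Σ (ℕ → ℕ) λ n → ∀ i → start n (suc i) ≡ p i
grouping p 1≤p₀ p< = n , starts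
  where
  n : ℕ → ℕ
  n zero    = Nat.pred (p 0)
  n (suc i) = Nat.pred (p (suc i) ∸ p i)
  suc-pred-pos : ∀ {m} → 1 ≤ m → suc (Nat.pred m) ≡ m
  suc-pred-pos (s≤s _) = refl
  starts : ∀ i → start n (suc i) ≡ p i
  starts zero    = suc-pred-pos 1≤p₀
  starts (suc i) = begin
    start n (suc i) + suc (n (suc i)) ≡⟨ cong₂ _+_ (starts i) (suc-pred-pos (m<n⇒0<n∸m (p< i))) ⟩
    p i + (p (suc i) ∸ p i)           ≡⟨ m+[n∸m]≡n (<⇒≤ (p< i)) ⟩
    p (suc i)                         ∎
    where open ≡-Reasoning

-- From recognizers to tree sequence automata

module Automata (em : ExcludedMiddle 0ℓ) (k₂ : ℕ) where
  open Geometry k₂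
  open Recognizers em k₂
  open Ramsey em

  module _ {A : Set} (R : Recognizer A) where
    open Recognizer R
    open IsMonoid monoid using (assoc; identityˡ; identityʳ)

    lasso : M → M → ℕ → M
    lasso s e zero    = s
    lasso s e (suc _) = e

    -- The linked pairs of ω-semigroup theory, restricted to those whose lasso is accepted.
    Linked : M → M → Set
    Linked s e = s ∙ e ≡ s × e ∙ e ≡ e × Acc (lasso s e)

    Factorization : (ℕ → M) → M → M → Set
    Factorization f s e = Σ (ℕ → ℕ) λ n → blocks f n ≗ lasso s e

    factorization-at : ∀ f {s e} (p : ℕ → ℕ) → 1 ≤ p 0 → (∀ i → p i < p (suc i)) →
      prod f (p 0) ≡ s → (∀ i → segment f (p i) (p (suc i) ∸ p i) ≡ e) → Factorization f s e
    factorization-at f p 1≤p₀ p< s≡ e≡ with n , starts ← grouping p 1≤p₀ p< = n , λ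
      { zero    → trans (cong (prod f) (starts 0)) s≡
      ; (suc i) → trans (cong₂ (segment f) (starts i) (length n starts i)) (e≡ i)
      }
      where
      length : ∀ n → (∀ i → start n (suc i) ≡ p i) → ∀ i → suc (n (suc i)) ≡ p (suc i) ∸ p i
      length n starts i = begin
        suc (n (suc i))                                       ≡⟨ m+n∸m≡n (start n (suc i)) _ ⟨
        start n (suc i) + suc (n (suc i)) ∸ start n (suc i)   ≡⟨ cong₂ _∸_ (starts (suc i)) (starts i) ⟩
        p (suc i) ∸ p i                                       ∎
        where open ≡-Reasoning

    between : (ℕ → M) → ℕ → ℕ → M
    between f i j = segment f i (j ∸ i)

    between-∙ : ∀ f {i j l} → i ≤ j → j ≤ l → between f i l ≡ between f i j ∙ between f j l
    between-∙ f {i} {j} {l} i≤j j≤l = begin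
      segment f i (l ∸ i)                             ≡⟨ cong (segment f i) lengths ⟩
      segment f i ((j ∸ i) + (l ∸ j))                 ≡⟨ prod-+ monoid (λ o → f (i + o)) (j ∸ i) (l ∸ j) ⟩
      segment f i (j ∸ i) ∙ prod (λ o → f (i + ((j ∸ i) + o))) (l ∸ j)
        ≡⟨ cong (between f i j ∙_) (prod-cong (l ∸ j) λ o _ → cong f (shift o)) ⟩
      between f i j ∙ between f j l                   ∎
      where
      open ≡-Reasoning
      shift : ∀ o → i + ((j ∸ i) + o) ≡ j + o
      shift o = trans (sym (+-assoc i (j ∸ i) o)) (cong (_+ o) (m+[n∸m]≡n i≤j))
      lengths : l ∸ i ≡ (j ∸ i) + (l ∸ j)
      lengths = +-cancelˡ-≡ i _ _ (begin
        i + (l ∸ i)             ≡⟨ m+[n∸m]≡n (≤-trans i≤j j≤l) ⟩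
        l                       ≡⟨ m+[n∸m]≡n j≤l ⟨
        j + (l ∸ j)             ≡⟨ shift (l ∸ j) ⟨
        i + ((j ∸ i) + (l ∸ j)) ∎)

    linked-factorization : ∀ f → Acc f → ∃₂ λ s e → Factorization f s e × Linked s e
    linked-factorization f acc
      with h , ê , h< , col ← ramsey (λ i j → enc finite-M (between f i j)) =
      s , e , fact , s∙e , e∙e , Acc-resp (proj₂ fact) (Acc-blocks f _ acc)
      where
      s e : M
      -- Cutting at `h 1` instead of `h 0` makes `s` end with a factor `e`, so that idempotence of
      -- `e` yields `s ∙ e ≡ s`.
      s = prod f (h 1)
      e = dec finite-M ê
      idem : ∀ {i j} → i < j → between f (h i) (h j) ≡ e
      idem i<j = trans (sym (dec-enc finite-M _)) (cong (dec finite-M) (col i<j))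
      fact : Factorization f s e
      fact = factorization-at f (h ∘ suc) (≤-trans (s≤s z≤n) (h< 0)) (h< ∘ suc) refl
        (λ i → idem (s≤s ≤-refl))
      e∙e : e ∙ e ≡ e
      e∙e = trans (sym (cong₂ _∙_ (idem {0} {1} ≤-refl) (idem {1} {2} ≤-refl)))
        (trans (sym (between-∙ f (<⇒≤ (h< 0)) (<⇒≤ (h< 1)))) (idem (s≤s z≤n)))
      s≡ : s ≡ between f 0 (h 0) ∙ e
      s≡ = trans (between-∙ f z≤n (<⇒≤ (h< 0))) (cong (between f 0 (h 0) ∙_) (idem ≤-refl))
      s∙e : s ∙ e ≡ s
      s∙e = begin
        s ∙ e                        ≡⟨ cong (_∙ e) s≡ ⟩
        (between f 0 (h 0) ∙ e) ∙ e  ≡⟨ assoc _ _ _ ⟩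
        between f 0 (h 0) ∙ (e ∙ e)  ≡⟨ cong (between f 0 (h 0) ∙_) e∙e ⟩
        between f 0 (h 0) ∙ e        ≡⟨ s≡ ⟨
        s                            ∎
        where open ≡-Reasoning

    -- waiting with the product of the prefix read so far, or cutting the rest
    -- into blocks of value e, with the product of the current block and a flag
    -- telling whether this block has just been opened.
    Q : Set
    Q = M ⊎ (M × M × Bool)

    finite-Q : Finite Q
    finite-Q = finite-⊎ finite-M (finite-× finite-M (finite-× finite-M finite-Bool))

    pattern waiting x     = inj₁ x
    pattern looping e x b = inj₂ (e , x , b)

    -- The run guesses `e` and the end of the prefix in `enter`, and the ends of blocks in `close`.
    -- Whether the guessed pair is accepted is checked on entry, being a fact about two elements of
    -- `M`.
    data Step : Q → M → Q → Set where
      wait  : ∀ {x m} → Step (waiting x) m (waiting (x ∙ m))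
      enter : ∀ {x m e} → Linked (x ∙ m) e → Step (waiting x) m (looping e ε true)
      stay  : ∀ {e x b m} → Step (looping e x b) m (looping e (x ∙ m) false)
      close : ∀ {e x b m} → x ∙ m ≡ e → Step (looping e x b) m (looping e ε true)

    BüchiRun : (ℕ → M) → (ℕ → Q) → Set
    BüchiRun f σ = σ 0 ≡ waiting ε × (∀ i → Step (σ i) (f i) (σ (suc i)))
                 × ∃[ e ] Infinite (λ i → σ i ≡ looping e ε true)

    acc⇒run : ∀ f → Acc f → ∃[ σ ] BüchiRun f σ
    acc⇒run f acc with s , e , (n , fact) , linked ← linked-factorization f acc =
      (state ∘ locate) , refl , step , e ,
      λ m → start n (suc m) + 0 ,
            ≤-trans (≤-trans (n≤1+n m) (i≤start n (suc m))) (m≤m+n _ 0) ,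
            cong state (locate-position (suc m) 0 z≤n)
      where
      open Locate n

      opened : ℕ → Bool
      opened zero    = true
      opened (suc _) = false

      state : ℕ × ℕ → Q
      state (zero  , o) = waiting (prod f o)
      state (suc i , o) = looping e (segment f (start n (suc i)) o) (opened o)

      advance : ∀ i o → o ≤ n i → Step (state (i , o)) (f (start n i + o)) (state (next (i , o)))
      advance i o o≤n with o <ᵇ n i | <ᵇ-reflects-< o (n i)
      advance zero    o o≤n | true  | _ = wait
      advance (suc i) o o≤n | true  | _ = stay
      advance zero    o o≤n | false | ofⁿ o≮n with refl ← ≤-antisym o≤n (≮⇒≥ o≮n) =
        enter (subst (λ s → Linked s e) (sym (fact 0)) linked)
      advance (suc i) o o≤n | false | ofⁿ o≮n with refl ← ≤-antisym o≤n (≮⇒≥ o≮n) =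
        close (fact (suc i))

      step : ∀ j → Step (state (locate j)) (f j) (state (locate (suc j)))
      step j = subst (λ i → Step (state (locate j)) (f i) (state (locate (suc j))))
        (position-locate j) (advance _ _ (locate-bounded j))

    run⇒acc : ∀ f σ → BüchiRun f σ → Acc f
    run⇒acc f σ (σ₀ , steps , e , inf) =
      let (s , linked@(_ , e∙e , acc) , s≡) = prefix-invariant (p 0) (visits 0)
          (n , fact) = factorization-at f p 1≤p₀ p< s≡ (block-value e∙e)
      in Acc-unblocks f n (Acc-resp (sym ∘ fact) acc)
      where
      visiting : Infinite (λ i → 1 ≤ i × σ i ≡ looping e ε true)
      visiting m = let (i , m<i , σi) = inf (suc m) in
        i , <⇒≤ m<i , ≤-trans (s≤s z≤n) m<i , σi
      enumeration = enumerate visiting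
      p = proj₁ enumeration
      visits : ∀ i → σ (p i) ≡ looping e ε true
      visits i = proj₂ (proj₁ (proj₂ enumeration) i)
      p< = proj₂ (proj₂ enumeration)
      1≤p₀ = proj₁ (proj₁ (proj₂ enumeration) 0)

      -- Closed blocks are absorbed because `s ∙ e ≡ s`, so only the open block remains visible to
      -- the right of `s`.
      Prefix : ℕ → Q → Set
      Prefix i (waiting x)     = prod f i ≡ x
      Prefix i (looping e x _) = ∃[ s ] Linked s e × prod f i ≡ s ∙ x

      prefix-step : ∀ {i q q′} → Step q (f i) q′ → Prefix i q → Prefix (suc i) q′
      prefix-step wait       pre = cong (_∙ _) pre
      prefix-step (enter ln) pre = _ , ln , trans (cong (_∙ _) pre) (sym (identityʳ _))
      prefix-step stay (s , ln , pre) = s , ln , trans (cong (_∙ _) pre) (assoc _ _ _)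
      prefix-step (close x∙m≡e) (s , ln , pre) = s , ln ,
        trans (cong (_∙ _) pre) (trans (assoc _ _ _) (trans (cong (s ∙_) x∙m≡e)
          (trans (proj₁ ln) (sym (identityʳ s)))))

      prefixes : ∀ i → Prefix i (σ i)
      prefixes zero    = subst (Prefix 0) (sym σ₀) refl
      prefixes (suc i) = prefix-step (steps i) (prefixes i)

      prefix-invariant : ∀ i → σ i ≡ looping e ε true → ∃[ s ] Linked s e × prod f i ≡ s
      prefix-invariant i σi = let (s , ln , pre) = subst (Prefix i) σi (prefixes i) in
        s , ln , trans pre (identityʳ s)

      -- Several blocks may be closed between two chosen visits; by idempotence they count as a
      -- single `e`, which is the second alternative. In the first none has been closed since `h`,
      -- and then the flag can be set only at `h` itself. This excludes an open block whose product
      -- merely happens to be `ε`.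
      Block : ℕ → ℕ → Q → Set
      Block h n (waiting _)      = ⊥
      Block h n (looping e′ x b) = e′ ≡ e ×
        ((segment f h n ≡ x × (b ≡ true → n ≡ 0)) ⊎ segment f h n ≡ e ∙ x)

      module _ (e∙e : e ∙ e ≡ e) where
        block-step : ∀ h {n q q′} → Step q (f (h + n)) q′ → Block h n q → Block h (suc n) q′
        block-step h stay (refl , inj₁ (seg , _)) = refl , inj₁ (cong (_∙ _) seg , λ ())
        block-step h stay (refl , inj₂ seg)       = refl , inj₂ (trans (cong (_∙ _) seg) (assoc _ _ _))
        block-step h (close x∙m≡e) (refl , inj₁ (seg , _)) =
          refl , inj₂ (trans (cong (_∙ _) seg) (trans x∙m≡e (sym (identityʳ e))))
        block-step h (close x∙m≡e) (refl , inj₂ seg) =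
          refl , inj₂ (trans (cong (_∙ _) seg) (trans (assoc _ _ _) (trans (cong (e ∙_) x∙m≡e)
            (trans e∙e (sym (identityʳ e))))))

        block-invariant : ∀ h → σ h ≡ looping e ε true → ∀ n → Block h n (σ (h + n))
        block-invariant h σh zero    =
          subst (Block h 0) (sym (trans (cong σ (+-identityʳ h)) σh)) (refl , inj₁ (refl , λ _ → refl))
        block-invariant h σh (suc n) =
          subst (λ i → Block h (suc n) (σ i)) (sym (+-suc h n))
            (block-step h (steps (h + n)) (block-invariant h σh n))

        block-value : ∀ i → segment f (p i) (p (suc i) ∸ p i) ≡ e
        block-value i
          with subst (Block (p i) (p (suc i) ∸ p i))
                 (trans (cong σ (m+[n∸m]≡n (<⇒≤ (p< i)))) (visits (suc i)))
                 (block-invariant (p i) (visits i) (p (suc i) ∸ p i))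
        ... | _ , inj₂ seg        = trans seg (identityʳ e)
        ... | _ , inj₁ (_ , null) =
          ⊥-elim (<-irrefl (sym (null refl)) (m<n⇒0<n∸m (p< i)))

    module _ (m : M) where
      private
        finite-state : Finite (Maybe S)
        finite-state = finite-Maybe finite-S

        code : Maybe S → Fin (card finite-state)
        code = enc finite-state

        decode : Fin (card finite-state) → Maybe S
        decode = dec finite-state

        RootTransition : A → Vec (Maybe S) (suc k₂) → Set
        RootTransition a qs = ∃[ ss ] (∀ i → lookup qs i ≡ just (lookup ss i)) × rootM a ss ≡ m

        NodeTransition : Maybe S → A → Vec (Maybe S) k → Set
        NodeTransition q a qs = ∃[ ss ] (∀ i → lookup qs i ≡ just (lookup ss i)) × q ≡ just (nodeS a ss)

        -- A leaf in state `nothing` is the whole slice of height 0.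
        LeafTransition : Maybe S → A → Set
        LeafTransition nothing  a = leafM a ≡ m
        LeafTransition (just s) a = s ≡ leafS a

      -- nothing is the state of the root, just s that of a node whose subtree has value s.
      valueAutomaton : TreeAutomaton k A
      valueAutomaton = record
        { states = card finite-state
        ; init   = code nothing
        ; rootΔ  = λ _ a qs → does (em {RootTransition a (map decode qs)})
        ; nodeΔ  = λ q a qs → does (em {NodeTransition (decode q) a (map decode qs)})
        ; leafΔ  = λ q a _ → does (em {LeafTransition (decode q) a})
        ; final  = tabulate λ _ → true
        }

      private
        module T = TreeAutomaton valueAutomaton

        final-all : ∀ q → q ∈ T.final
        final-all q = lookup⇒[]= q T.final (lookup∘tabulate _ q)

        leaf-value : ∀ {a q s} → LeafOK valueAutomaton a q → decode q ≡ just s → s ≡ leafS a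
        leaf-value {a} (_ , δ , _) q≡ = subst (λ q → LeafTransition q a) q≡ (does⁻ em δ)

        sons-value : ∀ {n b} (rs : Vec (Complete k (Fin T.states) b) n) ss →
          (∀ i → lookup (map decode (map label rs)) i ≡ just (lookup ss i)) →
          ∀ i → decode (label (lookup rs i)) ≡ just (lookup ss i)
        sons-value rs ss qs≡ i = trans (sym (trans (lookup-map i decode (map label rs))
          (cong decode (lookup-map i label rs)))) (qs≡ i)

        module _ (ℓ : Point → A) where
          -- Values are guessed from the top, but each guess is checked against those at the sons
          -- and finally at the leaves, so a run can only carry the true values.
          run-value : ∀ a b r {s} → Respects valueAutomaton (subtree k ℓ a b) r →
                      decode (label r) ≡ just s → s ≡ val ℓ a b
          run-value a zero    (leaf q)    ok       q≡ = leaf-value ok q≡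
          run-value a (suc b) (node q rs) (δ , oks) q≡
            with ss , qs≡ , q≡′ ← does⁻ em δ = trans (just-injective (trans (sym q≡) q≡′))
              (cong (nodeS _) (trans (sym (tabulate∘lookup ss)) (tabulate-cong λ i →
                run-value (a * k + toℕ i) b (lookup rs i)
                  (subst (λ t → Respects valueAutomaton t (lookup rs i))
                    (lookup∘tabulate (λ (i : Fin k) → subtree k ℓ (a * k + toℕ i) b) i) (oks i))
                  (sons-value rs ss qs≡ i))))

          run⇒word : ∀ i r → IsRun valueAutomaton (slice k ℓ i) r → word ℓ i ≡ m
          run⇒word zero (leaf q) (q≡ , _ , δ , _) =
            subst (λ q → LeafTransition q (ℓ (0 , 0))) (trans (cong decode q≡) (dec-enc finite-state nothing))
              (does⁻ em δ)
          run⇒word (suc b) (root q rs) (q≡ , δ , oks) with ss , qs≡ , m≡ ← does⁻ em δ =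
            trans (cong (rootM _) (sym (trans (sym (tabulate∘lookup ss)) (tabulate-cong λ j →
              run-value (suc (toℕ j)) b (lookup rs j)
                (subst (λ t → Respects valueAutomaton t (lookup rs j))
                  (lookup∘tabulate (λ (j : Fin (suc k₂)) → subtree k ℓ (suc (toℕ j)) b) j) (oks j))
                (sons-value rs ss qs≡ j)))))
              m≡

          -- The leftmost points are the roots of the slices, so one global labelling restricts to
          -- the run on each slice.
          runLabel : Point → Fin T.states
          runLabel (zero  , b) = code nothing
          runLabel (suc a , b) = code (just (val ℓ (suc a) b))

          sons-coded : ∀ {n b} (a : Fin n → ℕ) →
            ∀ i → lookup (map decode (map label (tabulate λ i → subtree k runLabel (suc (a i)) b))) i
                  ≡ just (lookup (tabulate λ i → val ℓ (suc (a i)) b) i)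
          sons-coded {b = b} a i = begin
            lookup (map decode (map label ts)) i         ≡⟨ lookup-map i decode (map label ts) ⟩
            decode (lookup (map label ts) i)             ≡⟨ cong decode (lookup-map i label ts) ⟩
            decode (label (lookup ts i))
              ≡⟨ cong (decode ∘ label) (lookup∘tabulate (λ i → subtree k runLabel (suc (a i)) b) i) ⟩
            decode (label (subtree k runLabel (suc (a i)) b)) ≡⟨ cong decode (label-subtree runLabel (suc (a i)) b) ⟩
            decode (code (just (val ℓ (suc (a i)) b)))   ≡⟨ dec-enc finite-state _ ⟩
            just (val ℓ (suc (a i)) b)
              ≡⟨ cong just (lookup∘tabulate (λ i → val ℓ (suc (a i)) b) i) ⟨
            just (lookup (tabulate λ i → val ℓ (suc (a i)) b) i) ∎
            where
            open ≡-Reasoning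
            ts = tabulate λ i → subtree k runLabel (suc (a i)) b

          value-respects : ∀ a b →
            Respects valueAutomaton (subtree k ℓ (suc a) b) (subtree k runLabel (suc a) b)
          value-respects a zero    = code nothing ,
            does⁺ em (subst (λ q → LeafTransition q (ℓ (suc a , 0))) (sym (dec-enc finite-state (just (val ℓ (suc a) 0)))) refl) ,
            final-all _
          value-respects a (suc b) =
            does⁺ em (_ , sons-coded (λ (i : Fin k) → suc (k₂ + a * k) + toℕ i) , dec-enc finite-state _) ,
            λ i → subst₂ (Respects valueAutomaton)
              (sym (lookup∘tabulate (λ (i : Fin k) → subtree k ℓ (suc a * k + toℕ i) b) i))
              (sym (lookup∘tabulate (λ (i : Fin k) → subtree k runLabel (suc a * k + toℕ i) b) i))
              (value-respects (suc (k₂ + a * k) + toℕ i) b)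

          word⇒run : ∀ i → word ℓ i ≡ m → IsRun valueAutomaton (slice k ℓ i) (slice k runLabel i)
          word⇒run zero    m≡ = refl , code nothing ,
            does⁺ em (subst (λ q → LeafTransition q (ℓ (0 , 0))) (sym (dec-enc finite-state nothing)) m≡) ,
            final-all _
          word⇒run (suc b) m≡ = refl ,
            does⁺ em (_ , sons-coded {suc k₂} toℕ , m≡) ,
            λ j → subst₂ (Respects valueAutomaton)
              (sym (lookup∘tabulate (λ (j : Fin (suc k₂)) → subtree k ℓ (suc (toℕ j)) b) j))
              (sym (lookup∘tabulate (λ (j : Fin (suc k₂)) → subtree k runLabel (suc (toℕ j)) b) j))
              (value-respects (toℕ j) b)

      valueAutomaton-Lᵗ : ∀ ℓ i → Lᵗ valueAutomaton (sequence k ℓ i) ⇔ (word ℓ i ≡ m)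
      valueAutomaton-Lᵗ ℓ i = mk⇔ (λ (r , run) → run⇒word ℓ i r run) (λ m≡ → _ , word⇒run ℓ i m≡)

    private
      Accepting : Q → Set
      Accepting q = ∃[ e ] q ≡ looping e ε true

    -- Each slice is accepted by exactly one member of `Γ`, the one for its value, so choosing `B`
    -- amounts to reading a letter of `M`.
    sequenceAutomaton : SeqAutomaton k A
    sequenceAutomaton = record
      { states = card finite-Q
      ; size   = card finite-M
      ; Γ      = tabulate λ i → valueAutomaton (dec finite-M i)
      ; init   = enc finite-Q (waiting ε)
      ; Δ      = λ q i q′ → does (em {Step (dec finite-Q q) (dec finite-M i) (dec finite-Q q′)})
      ; final  = tabulate λ q → does (em {Accepting (dec finite-Q q)})
      }

    private
      module X = SeqAutomaton sequenceAutomaton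

      T⇒true : ∀ {b} → T b → b ≡ true
      T⇒true {true} _ = refl

      final⁺ : ∀ {q} → Accepting (dec finite-Q q) → q ∈ X.final
      final⁺ {q} acc = lookup⇒[]= q X.final (trans (lookup∘tabulate _ q) (T⇒true (does⁺ em acc)))

      final⁻ : ∀ {q} → q ∈ X.final → Accepting (dec finite-Q q)
      final⁻ {q} q∈ = does⁻ em (subst T (trans (sym ([]=⇒lookup q∈)) (lookup∘tabulate _ q)) tt)

      Γ-value : ∀ ℓ i B → Lᵗ (lookup X.Γ B) (sequence k ℓ i) ⇔ (word ℓ i ≡ dec finite-M B)
      Γ-value ℓ i B = subst (λ Y → Lᵗ Y (sequence k ℓ i) ⇔ (word ℓ i ≡ dec finite-M B))
        (sym (lookup∘tabulate (λ i → valueAutomaton (dec finite-M i)) B)) (valueAutomaton-Lᵗ _ ℓ i)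

    sequenceAutomaton-L : ∀ ℓ → L sequenceAutomaton (sequence k ℓ) ⇔ Accepts ℓ
    sequenceAutomaton-L ℓ = mk⇔
      (λ (σ , σ₀ , steps , q , q∈ , inf) →
        let (e , q≡) = final⁻ q∈ in
        run⇒acc (word ℓ) (dec finite-Q ∘ σ)
          ( trans (cong (dec finite-Q) σ₀) (dec-enc finite-Q _)
          , (λ i → let (B , δ , run) = steps i in
              subst (λ m → Step (dec finite-Q (σ i)) m (dec finite-Q (σ (suc i))))
                (sym (to (Γ-value ℓ i B) run)) (does⁻ em δ))
          , e , λ m → let (i , m≤i , σi) = inf m in i , m≤i , trans (cong (dec finite-Q) σi) q≡))
      (λ acc → let (σ , σ₀ , steps , e , inf) = acc⇒run (word ℓ) acc in
        enc finite-Q ∘ σ , cong (enc finite-Q) σ₀ ,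
        (λ i → enc finite-M (word ℓ i) ,
               does⁺ em (subst₂ (λ q (m , q′) → Step q m q′) (sym (dec-enc finite-Q _))
                 (sym (cong₂ _,_ (dec-enc finite-M _) (dec-enc finite-Q _))) (steps i)) ,
               from (Γ-value ℓ i _) (sym (dec-enc finite-M _))) ,
        enc finite-Q (looping e ε true) , final⁺ (e , dec-enc finite-Q _) ,
        λ m → let (i , m≤i , σi) = inf m in i , m≤i , cong (enc finite-Q) σi)

-- Closure properties of definable relations

module Definability (em : ExcludedMiddle 0ℓ) (k p : ℕ) where
  Relation : ℕ → ℕ → Set₁
  Relation n m = UULS k p → Vec Point n → Vec PointSet m → Set

  Definable : ∀ {n m} → Relation n m → Set
  Definable {n} {m} D = Σ (Formula k p n m) λ φ → ∀ t ρ θ → Sat t ρ θ φ ⇔ D t ρ θ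

  private
    variable
      n m : ℕ

  definable-¬ : {D : Relation n m} → Definable D → Definable (λ t ρ θ → ¬ D t ρ θ)
  definable-¬ (φ , sat) = neg φ , λ t ρ θ →
    mk⇔ (_∘ from (sat t ρ θ)) (_∘ to (sat t ρ θ))

  definable-× : {D E : Relation n m} → Definable D → Definable E →
                Definable (λ t ρ θ → D t ρ θ × E t ρ θ)
  definable-× (φ , sat) (ψ , sat′) = and φ ψ , λ t ρ θ →
    mk⇔ (λ (x , y) → to (sat t ρ θ) x , to (sat′ t ρ θ) y)
        (λ (x , y) → from (sat t ρ θ) x , from (sat′ t ρ θ) y)

  definable-cong : {D E : Relation n m} → (∀ t ρ θ → D t ρ θ ⇔ E t ρ θ) → Definable D → Definable E
  definable-cong D⇔E (φ , sat) = φ , λ t ρ θ →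
    mk⇔ (to (D⇔E t ρ θ) ∘ to (sat t ρ θ)) (from (sat t ρ θ) ∘ from (D⇔E t ρ θ))

  definable-⊎ : {D E : Relation n m} → Definable D → Definable E →
                Definable (λ t ρ θ → D t ρ θ ⊎ E t ρ θ)
  definable-⊎ D E = definable-cong
    (λ t ρ θ → mk⇔ decide λ { (inj₁ x) (¬x , _) → ¬x x ; (inj₂ y) (_ , ¬y) → ¬y y })
    (definable-¬ (definable-× (definable-¬ D) (definable-¬ E)))
    where
    decide : ∀ {X Y : Set} → ¬ (¬ X × ¬ Y) → X ⊎ Y
    decide {X} {Y} h with em {X} | em {Y}
    ... | yes x | _     = inj₁ x
    ... | no _  | yes y = inj₂ y
    ... | no ¬x | no ¬y = ⊥-elim (h (¬x , ¬y))

  definable-∃₁ : {D : Relation (suc n) m} → Definable D →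
                 Definable {n} (λ t ρ θ → ∃[ x ] D t (x ∷ ρ) θ)
  definable-∃₁ (φ , sat) = ex₁ φ , λ t ρ θ →
    mk⇔ (λ (x , d) → x , to (sat t _ θ) d) (λ (x , d) → x , from (sat t _ θ) d)

  definable-∀₁ : {D : Relation (suc n) m} → Definable D →
                 Definable {n} (λ t ρ θ → ∀ x → D t (x ∷ ρ) θ)
  definable-∀₁ d = definable-cong
    (λ t ρ θ → mk⇔ (λ ¬∃ x → decidable-stable em λ ¬d → ¬∃ (x , ¬d)) (λ ∀x (x , ¬d) → ¬d (∀x x)))
    (definable-¬ (definable-∃₁ (definable-¬ d)))

  -- Excluded middle picks a valid or an unsatisfiable formula. In this way the transition tables of
  -- an automaton enter a formula.
  definable-const : (P : Set) → Definable {n} {m} (λ _ _ _ → P)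
  definable-const P with em {P}
  ... | yes p = neg (ex₁ (neg (eq zero zero))) , λ t ρ θ →
    mk⇔ (λ _ → p) (λ _ (_ , x≢x) → x≢x refl)
  ... | no ¬p = ex₁ (neg (eq zero zero)) , λ t ρ θ →
    mk⇔ (λ (_ , x≢x) → ⊥-elim (x≢x refl)) (⊥-elim ∘ ¬p)

  definable-∀Fin : ∀ {l} {D : Fin l → Relation n m} → (∀ i → Definable (D i)) →
                   Definable (λ t ρ θ → ∀ i → D i t ρ θ)
  definable-∀Fin {l = zero}  d = definable-cong (λ t ρ θ → mk⇔ (λ _ ()) (λ _ → tt)) (definable-const ⊤)
  definable-∀Fin {l = suc l} d = definable-cong
    (λ t ρ θ → mk⇔ (λ { (d₀ , ds) zero → d₀ ; (d₀ , ds) (suc i) → ds i })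
                   (λ ds → ds zero , ds ∘ suc))
    (definable-× (d zero) (definable-∀Fin (d ∘ suc)))

  definable-∃Finite : ∀ {X : Set} → Finite X → {D : X → Relation n m} → (∀ x → Definable (D x)) →
                      Definable (λ t ρ θ → ∃[ x ] D x t ρ θ)
  definable-∃Finite fin {D} d = definable-cong
    (λ t ρ θ → mk⇔ (λ ¬∀ → decidable-stable em λ ¬∃ → ¬∀ λ i x → ¬∃ (_ , x))
                   (λ (x , dx) ¬d → ¬d (enc fin x) (subst (λ x → D x t ρ θ) (sym (dec-enc fin x)) dx)))
    (definable-¬ (definable-∀Fin λ i → definable-¬ (d (dec fin i))))

  definable-less : ∀ i j → Definable {n} {m} (λ t ρ θ → Inorder k (lookup ρ i) (lookup ρ j))
  definable-less i j = less i j , λ _ _ _ → mk⇔ id id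

  definable-proj : ∀ c i j → Definable {n} {m} (λ t ρ θ → ↓ c (lookup ρ i) ≡ just (lookup ρ j))
  definable-proj c i j = proj c i j , λ _ _ _ → mk⇔ id id

  definable-inSet : ∀ i j → Definable {n} {m} (λ t ρ θ → T (lookup θ j (lookup ρ i)))
  definable-inSet i j = inSet i j , λ _ _ _ → mk⇔ id id

  definable-pred : ∀ i P → Definable {n} {m} (λ t ρ θ → T (interp t P (lookup ρ i)))
  definable-pred i P = pred i P , λ _ _ _ → mk⇔ id id

  definable-∃sets : ∀ {n m} {D : Relation n m} → Definable D →
                    Definable {n} {0} (λ t ρ _ → ∃[ θ ] D t ρ θ)
  definable-∃sets (φ , sat) = close φ , λ t ρ θ → mk⇔
    (λ s → let (θ , s′) = to (sat-close φ t ρ) s in θ , to (sat t ρ θ) s′)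
    (λ (θ , d) → from (sat-close φ t ρ) (θ , from (sat t ρ θ) d))
    where
    close : ∀ {n m} → Formula k p n m → Formula k p n 0
    close {m = zero}  φ = φ
    close {m = suc m} φ = close (ex₂ φ)
    sat-close : ∀ {n m} (φ : Formula k p n m) t ρ {θ₀} → Sat t ρ θ₀ (close φ) ⇔ (∃[ θ ] Sat t ρ θ φ)
    sat-close {m = zero}  φ t ρ {[]} = mk⇔ ([] ,_) (λ { ([] , s) → s })
    sat-close {m = suc m} φ t ρ = mk⇔
      (λ s → let (θ , X , s′) = to (sat-close (ex₂ φ) t ρ) s in X ∷ θ , s′)
      (λ { (X ∷ θ , s) → from (sat-close (ex₂ φ) t ρ) (θ , X , s) })

-- Accepting runs as labellings of all points

module Runs (em : ExcludedMiddle 0ℓ) (k₂ : ℕ) {s : ℕ} (A : SeqAutomaton (suc (suc k₂)) (Fin s)) where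
  open Geometry k₂
  open Order k₂
  open SeqAutomaton A

  module Γ (B : Fin size) = TreeAutomaton (lookup Γ B)

  -- A state is tagged with its tree automaton, so that all points can be labelled from one finite
  -- type; `Off` keeps the tag constant inside a slice.
  W : Set
  W = Σ (Fin size) λ B → Fin (Γ.states B)

  -- A run of A as a labelling of all points. The flag marks the leftmost points
  -- 0_i; there the second component is the state σ i.
  R : Set
  R = Bool × Fin states × W

  Off : R → W → Set
  Off (b , _ , w) w′ = b ≡ false × w ≡ w′

  LeafAllowed : Fin s → R → Set
  LeafAllowed a (true  , q , B , st) = q ≡ init × st ≡ Γ.init B × LeafOK (lookup Γ B) a st
  LeafAllowed a (false , q , B , st) = LeafOK (lookup Γ B) a st

  -- The step from σ b to σ (b+1) is checked at 0_(b+1), which sees through its leftmost son both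
  -- the state and the tree automaton at 0_b.
  NodeAllowed : Fin s → R → Vec R k → Set
  NodeAllowed a (true , q , B , st) (c ∷ cs) =
    (∃₂ λ q₀ w₀ → c ≡ (true , q₀ , w₀) × T (Δ q₀ (proj₁ w₀) q))
    × st ≡ Γ.init B
    × ∃[ sts ] (∀ j → Off (lookup cs j) (B , lookup sts j)) × T (Γ.rootΔ B st a sts)
  NodeAllowed a (false , q , B , st) cs =
    ∃[ sts ] (∀ i → Off (lookup cs i) (B , lookup sts i)) × T (Γ.nodeΔ B st a sts)

  OnPath : Fin states → R → Set
  OnPath q (b , q′ , _) = b ≡ true × q′ ≡ q

  Leftmost : R → Set
  Leftmost (b , _) = b ≡ true

  -- `leaves` and `nodes` alone make the flagged points an initial segment of the leftmost branch,
  -- possibly an empty one. `recurrent` provides a flagged point and, above every flagged point, a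
  -- further one in state `q`, so the whole branch is flagged and `q` recurs.
  record Tiling (ℓ : Point → Fin s) (r : Point → R) (q : Fin states) : Set where
    field
      leaves    : ∀ a → LeafAllowed (ℓ (a , 0)) (r (a , 0))
      nodes     : ∀ a b → NodeAllowed (ℓ (a , suc b)) (r (a , suc b))
                            (tabulate λ (i : Fin k) → r (a * k + toℕ i , b))
      recurrent : ∀ x → ∃[ y ] OnPath q (r y) × (¬ Leftmost (r x) ⊎ Inorder k x y)

  module FromTiling {ℓ r q} (tiling : Tiling ℓ r q) where
    open Tiling tiling

    flag : Point → Bool
    flag x = proj₁ (r x)

    state : Point → Fin states
    state x = proj₁ (proj₂ (r x))

    son-off : ∀ b (j : Fin (suc k₂)) → flag (suc (toℕ j) , b) ≡ false
    son-off b j with r (0 , suc b) | nodes 0 b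
    ... | true , _ , _  | _ , _ , _ , off , _ =
      trans (cong proj₁ (sym (lookup∘tabulate (λ (j : Fin (suc k₂)) → r (suc (toℕ j) , b)) j)))
            (proj₁ (off j))
    ... | false , _ , _ | _ , off , _ =
      trans (cong proj₁ (sym (lookup∘tabulate (λ (i : Fin k) → r (toℕ i , b)) (suc j))))
            (proj₁ (off (suc j)))

    child-off : ∀ a b (i : Fin k) → flag (a , suc b) ≡ false → flag (a * k + toℕ i , b) ≡ false
    child-off a b i e with r (a , suc b) | nodes a b
    child-off a b i refl | false , _ , _ | _ , off , _ =
      trans (cong proj₁ (sym (lookup∘tabulate (λ (i : Fin k) → r (a * k + toℕ i , b)) i)))
            (proj₁ (off i))

    non-leftmost-off : ∀ a b → flag (suc a , b) ≡ false
    non-leftmost-off = non-leftmost-ind (λ a b → flag (a , b) ≡ false) son-off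
      (λ a b → child-off (suc a) b)

    flagged⇒leftmost : ∀ {x} → flag x ≡ true → proj₁ x ≡ 0
    flagged⇒leftmost {zero  , b} _ = refl
    flagged⇒leftmost {suc a , b} e with () ← trans (sym e) (non-leftmost-off a b)

    flag-below : ∀ b → flag (0 , suc b) ≡ true → flag (0 , b) ≡ true
    flag-below b e with r (0 , suc b) | nodes 0 b
    flag-below b refl | true , _ , _ | (_ , _ , c≡ , _) , _ = cong proj₁ c≡

    flag-≤ : ∀ {b c} → b ≤ c → flag (0 , c) ≡ true → flag (0 , b) ≡ true
    flag-≤ b≤c = go (≤⇒≤′ b≤c)
      where
      go : ∀ {b c} → b ≤′ c → flag (0 , c) ≡ true → flag (0 , b) ≡ true
      go ≤′-refl       e = e
      go (≤′-step b≤c) e = go b≤c (flag-below _ e)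

    visit-after : ∀ m → ∃[ i ] m ≤ i × OnPath q (r (0 , i))
    -- Whether or not 0_0 is known to be flagged, `recurrent` yields some flagged point, from which
    -- the chain of visits starts.
    visit-after zero with (a , i) , on , _ ← recurrent (0 , 0) with refl ← flagged⇒leftmost (proj₁ on) =
      i , z≤n , on
    visit-after (suc m)
      with i , m≤i , on ← visit-after m
      with (a , j) , on′ , later ← recurrent (0 , i)
      with refl ← flagged⇒leftmost (proj₁ on′) | later
    ... | inj₁ ¬on = ⊥-elim (¬on (proj₁ on))
    ... | inj₂ i<j = j , ≤-<-trans m≤i (≤∧≢⇒< (Inorder-leftmost i<j) λ { refl → Inorder-irrefl i<j }) , on′

    leftmost-flagged : ∀ b → flag (0 , b) ≡ true
    leftmost-flagged b with i , b≤i , on , _ ← visit-after b = flag-≤ b≤i on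

    subtree-run : ∀ b a B st → Off (r (a , b)) (B , st) →
      Σ (Complete k (Fin (Γ.states B)) b) λ t →
        Respects (lookup Γ B) (subtree k ℓ a b) t × label t ≡ st
    subtree-run zero a B st (b≡ , w≡) with r (a , 0) | leaves a
    subtree-run zero a B st (refl , refl) | _ | ok = leaf st , ok , refl
    subtree-run (suc b) a B st (b≡ , w≡) with r (a , suc b) | nodes a b
    subtree-run (suc b) a B st (refl , refl) | _ | sts , off , δ =
      node st (tabulate (proj₁ ∘ sons)) ,
      (subst (λ qs → T (Γ.nodeΔ B st (ℓ (a , suc b)) qs)) (sym labels≡) δ ,
       λ i → subst₂ (Respects (lookup Γ B))
         (sym (lookup∘tabulate (λ (i : Fin k) → subtree k ℓ (a * k + toℕ i) b) i))
         (sym (lookup∘tabulate (proj₁ ∘ sons) i))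
         (proj₁ (proj₂ (sons i)))) ,
      refl
      where
      sons : ∀ (i : Fin k) → Σ (Complete k (Fin (Γ.states B)) b) λ t →
        Respects (lookup Γ B) (subtree k ℓ (a * k + toℕ i) b) t × label t ≡ lookup sts i
      sons i = subtree-run b (a * k + toℕ i) B (lookup sts i)
        (subst (λ c → Off c (B , lookup sts i))
          (lookup∘tabulate (λ (i : Fin k) → r (a * k + toℕ i , b)) i) (off i))
      labels≡ : map label (tabulate (proj₁ ∘ sons)) ≡ sts
      labels≡ = trans (sym (tabulate-∘ label (proj₁ ∘ sons)))
        (tabulate-lookup λ i → proj₂ (proj₂ (sons i)))

    B : ℕ → Fin size
    B i = proj₁ (proj₂ (proj₂ (r (0 , i))))

    slice-run : ∀ i → Lᵗ (lookup Γ (B i)) (sequence k ℓ i)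
    slice-run zero with r (0 , 0) | leftmost-flagged 0 | leaves 0
    ... | _ , _ , _ , st | refl | _ , st≡ , ok = leaf st , st≡ , ok
    slice-run (suc b) with r (0 , suc b) | leftmost-flagged (suc b) | nodes 0 b
    ... | _ , _ , B , st | refl | _ , st≡ , sts , off , δ =
      root st (tabulate (proj₁ ∘ sons)) , st≡ ,
      subst (λ qs → T (Γ.rootΔ B st (ℓ (0 , suc b)) qs)) (sym labels≡) δ ,
      λ j → subst₂ (Respects (lookup Γ B))
        (sym (lookup∘tabulate (λ (j : Fin (suc k₂)) → subtree k ℓ (suc (toℕ j)) b) j))
        (sym (lookup∘tabulate (proj₁ ∘ sons) j))
        (proj₁ (proj₂ (sons j)))
      where
      sons : ∀ (j : Fin (suc k₂)) → Σ (Complete k (Fin (Γ.states B)) b) λ t →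
        Respects (lookup Γ B) (subtree k ℓ (suc (toℕ j)) b) t × label t ≡ lookup sts j
      sons j = subtree-run b (suc (toℕ j)) B (lookup sts j)
        (subst (λ c → Off c (B , lookup sts j))
          (lookup∘tabulate (λ (j : Fin (suc k₂)) → r (suc (toℕ j) , b)) j) (off j))
      labels≡ : map label (tabulate (proj₁ ∘ sons)) ≡ sts
      labels≡ = trans (sym (tabulate-∘ label (proj₁ ∘ sons)))
        (tabulate-lookup λ j → proj₂ (proj₂ (sons j)))

    transition : ∀ i → T (Δ (state (0 , i)) (B i) (state (0 , suc i)))
    transition i with r (0 , suc i) | leftmost-flagged (suc i) | nodes 0 i
    ... | _ , q′ , _ | refl | (q₀ , w₀ , c≡ , δ) , _ =
      subst (λ c → T (Δ (proj₁ (proj₂ c)) (proj₁ (proj₂ (proj₂ c))) q′)) (sym c≡) δ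

    initial : state (0 , 0) ≡ init
    initial with r (0 , 0) | leftmost-flagged 0 | leaves 0
    ... | _ | refl | q≡ , _ = q≡

    accepted : q ∈ final → L A (sequence k ℓ)
    accepted q∈ = (λ i → state (0 , i)) , initial ,
      (λ i → B i , transition i , slice-run i) ,
      q , q∈ , λ m → let (i , m≤i , _ , q≡) = visit-after m in i , m≤i , q≡

  mapᶜ : ∀ {X Y : Set} {h} → (X → Y) → Complete k X h → Complete k Y h
  mapᶜ f (leaf x)    = leaf (f x)
  mapᶜ f (node x ts) = node (f x) (tabulate λ i → mapᶜ f (lookup ts i))

  mapᵃ : ∀ {X Y : Set} {h} → (X → Y) → Almost k X h → Almost k Y h
  mapᵃ f (leaf x)    = leaf (f x)
  mapᵃ f (root x ts) = root (f x) (tabulate λ i → mapᶜ f (lookup ts i))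

  label-mapᶜ : ∀ {X Y : Set} {h} (f : X → Y) (t : Complete k X h) → label (mapᶜ f t) ≡ f (label t)
  label-mapᶜ f (leaf _)   = refl
  label-mapᶜ f (node _ _) = refl

  module FromRun (ℓ : Point → Fin s) (σ : ℕ → Fin states) (B : ℕ → Fin size)
                 (σ₀ : σ 0 ≡ init)
                 (δ : ∀ i → T (Δ (σ i) (B i) (σ (suc i))))
                 (runs : ∀ i → Lᵗ (lookup Γ (B i)) (sequence k ℓ i)) where
    -- Runs of different tree automata are tagged with their indices `B i` and then glued along the
    -- slices.
    w : Point → W
    w = unslice λ i → mapᵃ (B i ,_) (proj₁ (runs i))

    slice-w : ∀ i → slice k w i ≡ mapᵃ (B i ,_) (proj₁ (runs i))
    slice-w = slice-unslice λ i → mapᵃ (B i ,_) (proj₁ (runs i))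

    r : Point → R
    r (zero  , b) = true  , σ b , w (0 , b)
    -- Off the leftmost branch `σ b` is a filler.
    r (suc a , b) = false , σ b , w (suc a , b)

    w-root : ∀ {a b B} {t : Complete k (Fin (Γ.states B)) b} →
      subtree k w a b ≡ mapᶜ (B ,_) t → w (a , b) ≡ (B , label t)
    w-root {a} {b} {B} {t} e =
      trans (sym (label-subtree w a b)) (trans (cong label e) (label-mapᶜ (B ,_) t))

    RunAt : ℕ → ℕ → Set
    RunAt a b = Σ (Fin size) λ B → Σ (Complete k (Fin (Γ.states B)) b) λ t →
      subtree k w a b ≡ mapᶜ (B ,_) t × Respects (lookup Γ B) (subtree k ℓ a b) t

    root-run : ∀ b → ∃₂ λ st rs →
      w (0 , suc b) ≡ (B (suc b) , st) × st ≡ Γ.init (B (suc b))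
      × T (Γ.rootΔ (B (suc b)) st (ℓ (0 , suc b)) (map label rs))
      × (∀ (j : Fin (suc k₂)) → subtree k w (suc (toℕ j)) b ≡ mapᶜ (B (suc b) ,_) (lookup rs j)
                              × Respects (lookup Γ (B (suc b))) (subtree k ℓ (suc (toℕ j)) b) (lookup rs j))
    root-run b with runs (suc b) | slice-w (suc b)
    ... | root st rs , st≡ , ok , oks | e with w≡ , ts≡ ← root-injective e =
      st , rs , w≡ , st≡ , ok , λ j →
        tabulate-injective (λ (j : Fin (suc k₂)) → subtree k w (suc (toℕ j)) b)
          (λ j → mapᶜ (B (suc b) ,_) (lookup rs j)) ts≡ j ,
        subst (λ t → Respects (lookup Γ (B (suc b))) t (lookup rs j))
          (lookup∘tabulate (λ (j : Fin (suc k₂)) → subtree k ℓ (suc (toℕ j)) b) j) (oks j)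

    node-run : ∀ a b (run : RunAt a (suc b)) → let B = proj₁ run in ∃₂ λ st rs →
      w (a , suc b) ≡ (B , st)
      × T (Γ.nodeΔ B st (ℓ (a , suc b)) (map label rs))
      × (∀ (i : Fin k) → subtree k w (a * k + toℕ i) b ≡ mapᶜ (B ,_) (lookup rs i)
                       × Respects (lookup Γ B) (subtree k ℓ (a * k + toℕ i) b) (lookup rs i))
    node-run a b (B , node st rs , e , ok , oks) with w≡ , ts≡ ← node-injective e =
      st , rs , w≡ , ok , λ i →
        tabulate-injective (λ (i : Fin k) → subtree k w (a * k + toℕ i) b)
          (λ i → mapᶜ (B ,_) (lookup rs i)) ts≡ i ,
        subst (λ t → Respects (lookup Γ B) t (lookup rs i))
          (lookup∘tabulate (λ (i : Fin k) → subtree k ℓ (a * k + toℕ i) b) i) (oks i)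

    runAt : ∀ a b → RunAt (suc a) b
    runAt = non-leftmost-ind RunAt
      (λ b j → let (_ , rs , _ , _ , _ , sons) = root-run b in B (suc b) , lookup rs j , sons j)
      (λ a b i run → let (_ , rs , _ , _ , sons) = node-run (suc a) b run in
        proj₁ run , lookup rs i , sons i)

    sons-off : ∀ {l B b} (a : Fin l → ℕ) (rs : Vec (Complete k (Fin (Γ.states B)) b) l) →
      (∀ j → subtree k w (suc (a j)) b ≡ mapᶜ (B ,_) (lookup rs j)) →
      ∀ j → Off (lookup (tabulate λ j → r (suc (a j) , b)) j) (B , lookup (map label rs) j)
    sons-off {B = B} {b} a rs e j = subst₂ Off
      (sym (lookup∘tabulate (λ j → r (suc (a j) , b)) j))
      (cong (B ,_) (sym (lookup-map j label rs)))
      (refl , w-root (e j))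

    leaves : ∀ a → LeafAllowed (ℓ (a , 0)) (r (a , 0))
    leaves zero with runs 0 | slice-w 0
    ... | leaf st , st≡ , ok | e rewrite cong rootLabel e = σ₀ , st≡ , ok
    leaves (suc a) with runAt a 0
    ... | B , leaf st , e , ok rewrite cong label e = ok

    nodes : ∀ a b → NodeAllowed (ℓ (a , suc b)) (r (a , suc b))
                      (tabulate λ (i : Fin k) → r (a * k + toℕ i , b))
    nodes zero b with st , rs , w≡ , st≡ , ok , sons ← root-run b rewrite w≡ =
      (_ , _ , refl , subst (λ B → T (Δ (σ b) B (σ (suc b)))) (sym (B≡ b)) (δ b)) ,
      st≡ , map label rs , sons-off toℕ rs (proj₁ ∘ sons) , ok
      where
      B≡ : ∀ b → proj₁ (w (0 , b)) ≡ B b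
      B≡ zero with runs 0 | slice-w 0
      ... | leaf st , _ | e = cong (proj₁ ∘ rootLabel) e
      B≡ (suc b) = cong proj₁ (proj₁ (proj₂ (proj₂ (root-run b))))
    nodes (suc a) b with node-run (suc a) b (runAt a (suc b))
    ... | st , rs , w≡ , ok , sons rewrite w≡ =
      map label rs , sons-off (λ (i : Fin k) → suc (k₂ + a * k) + toℕ i) rs (proj₁ ∘ sons) , ok

    tiling : ∀ {q} → InfinitelyOften A σ q → Tiling ℓ r q
    tiling inf = record
      { leaves    = leaves
      ; nodes     = nodes
      ; recurrent = λ
          { (zero  , b) → let (i , b<i , σi) = inf (suc b) in
              (0 , i) , (refl , σi) , inj₂ (leftmost-Inorder b<i)
          ; (suc a , b) → let (i , _ , σi) = inf 0 in (0 , i) , (refl , σi) , inj₁ λ ()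
          }
      }

  L⇔tiling : ∀ ℓ → L A (sequence k ℓ) ⇔ (∃[ q ] q ∈ final × Σ (Point → R) λ r → Tiling ℓ r q)
  L⇔tiling ℓ = mk⇔
    (λ (σ , σ₀ , steps , q , q∈ , inf) → q , q∈ , _ ,
      FromRun.tiling ℓ σ (proj₁ ∘ steps) σ₀ (proj₁ ∘ proj₂ ∘ steps) (proj₂ ∘ proj₂ ∘ steps) inf)
    (λ (q , q∈ , r , tiling) → FromTiling.accepted tiling q∈)

-- The formula stating that an accepting run exists

module RunFormula (em : ExcludedMiddle 0ℓ) (k₂ : ℕ) {s : ℕ} (A : SeqAutomaton (suc (suc k₂)) (Fin s)) where
  open Geometry k₂
  open Runs em k₂ A
  open Definability em k s
  open SeqAutomaton A using (states; size; Γ; final)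

  finite-R : Finite R
  finite-R = finite-× finite-Bool (finite-× (finite-Fin states)
    (finite-Σ size (λ B → Fin (TreeAutomaton.states (lookup Γ B))) λ B → finite-Fin _))

  -- One set variable for each label; the sets describe a labelling iff every
  -- point belongs to exactly one of them.
  Has : Vec PointSet (card finite-R) → Point → R → Set
  Has θ x c = ∀ j → T (lookup θ j x) ⇔ enc finite-R c ≡ j

  Has-unique : ∀ {θ x c c′} → Has θ x c → Has θ x c′ → c ≡ c′
  Has-unique {c = c} h h′ = sym (enc-injective finite-R (to (h′ _) (from (h (enc finite-R c)) refl)))

  characteristic : (Point → R) → Vec PointSet (card finite-R)
  characteristic r = tabulate λ j x → does (enc finite-R (r x) ≟ᶠ j)

  Has-characteristic : ∀ r x → Has (characteristic r) x (r x)
  Has-characteristic r x j = mk⇔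
    (λ t → does⁻ (enc finite-R (r x) ≟ᶠ j) (subst T member≡ t))
    (λ e → subst T (sym member≡) (does⁺ (enc finite-R (r x) ≟ᶠ j) e))
    where
    member≡ : lookup (characteristic r) j x ≡ does (enc finite-R (r x) ≟ᶠ j)
    member≡ = cong (λ (X : PointSet) → X x) (lookup∘tabulate (λ j x → does (enc finite-R (r x) ≟ᶠ j)) j)

  definable-Has : ∀ {n} i c → Definable {n} (λ t ρ θ → Has θ (lookup ρ i) c)
  definable-Has i c = definable-∀Fin λ j → literal j (enc finite-R c ≟ᶠ j)
    where
    literal : ∀ j → Dec (enc finite-R c ≡ j) →
              Definable (λ t ρ θ → T (lookup θ j (lookup ρ i)) ⇔ enc finite-R c ≡ j)
    literal j (yes e) = definable-cong (λ t ρ θ → mk⇔ (λ x → mk⇔ (λ _ → e) (λ _ → x)) (λ h → from h e))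
                          (definable-inSet i j)
    literal j (no ¬e) = definable-cong (λ t ρ θ → mk⇔ (λ ¬x → mk⇔ (⊥-elim ∘ ¬x) (⊥-elim ∘ ¬e))
                                                     (λ h x → ¬e (to h x)))
                          (definable-¬ (definable-inSet i j))

  NodeCase LeafCase LocallyAllowed : UULS k s → Vec PointSet (card finite-R) → Point → Set
  NodeCase t θ x = ∃[ a ] ∃[ c ] ∃[ cs ] T (interp t a x) × Has θ x c
    × (∀ (i : Fin k) → ∃[ y ] ↓ i x ≡ just y × Has θ y (lookup cs i)) × NodeAllowed a c cs
  LeafCase t θ x = (¬ (∃[ y ] ↓ {k} zero x ≡ just y))
    × ∃[ a ] ∃[ c ] T (interp t a x) × Has θ x c × LeafAllowed a c
  LocallyAllowed t θ x = NodeCase t θ x ⊎ LeafCase t θ x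

  Recurrent : Vec PointSet (card finite-R) → Fin states → Set
  Recurrent θ q = ∀ x → ∃[ y ] (∃[ c ] Has θ y c × OnPath q c)
                             × (¬ (∃[ c ] Has θ x c × Leftmost c) ⊎ Inorder k x y)

  EncodesRun : UULS k s → Vec PointSet (card finite-R) → Set
  EncodesRun t θ = (∀ x → LocallyAllowed t θ x) × ∃[ q ] q ∈ final × Recurrent θ q

  -- Letters, labels and tuples of labels are finite in number, so the local conditions become
  -- finite disjunctions whose transition checks are constants.
  definable-run : Definable {0} {0} (λ t ρ _ → ∃[ θ ] EncodesRun t θ)
  definable-run = definable-∃sets (definable-×
    (definable-∀₁ (definable-⊎
      (definable-∃Finite (finite-Fin s) λ a → definable-∃Finite finite-R λ c →
        definable-∃Finite (finite-Vec finite-R k) λ cs →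
        definable-× (definable-pred zero a) (definable-× (definable-Has zero c) (definable-×
          (definable-∀Fin λ i → definable-∃₁ (definable-×
            (definable-proj i (suc zero) zero) (definable-Has zero (lookup cs i))))
          (definable-const (NodeAllowed a c cs)))))
      (definable-× (definable-¬ (definable-∃₁ (definable-proj zero (suc zero) zero)))
        (definable-∃Finite (finite-Fin s) λ a → definable-∃Finite finite-R λ c →
          definable-× (definable-pred zero a) (definable-× (definable-Has zero c)
            (definable-const (LeafAllowed a c)))))))
    (definable-∃Finite (finite-Fin states) λ q → definable-× (definable-const (q ∈ final))
      (definable-∀₁ (definable-∃₁ (definable-×
        (definable-∃Finite finite-R λ c →
          definable-× (definable-Has zero c) (definable-const (OnPath q c)))
        (definable-⊎
          (definable-¬ (definable-∃Finite finite-R λ c →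
            definable-× (definable-Has (suc zero) c) (definable-const (Leftmost c))))
          (definable-less (suc zero) zero)))))))

  run⇔tiling : ∀ ℓ → (∃[ θ ] EncodesRun (letterUULS k ℓ) θ) ⇔
                     (∃[ q ] q ∈ final × Σ (Point → R) λ r → Tiling ℓ r q)
  run⇔tiling ℓ = mk⇔ decode encode
    where
    letter⁻ : ∀ {a x} → T (interp (letterUULS k ℓ) a x) → ℓ x ≡ a
    letter⁻ {a} {x} = does⁻ (ℓ x ≟ᶠ a)

    letter⁺ : ∀ x → T (interp (letterUULS k ℓ) (ℓ x) x)
    letter⁺ x = does⁺ (ℓ x ≟ᶠ ℓ x) refl

    decode : (∃[ θ ] EncodesRun (letterUULS k ℓ) θ) → ∃[ q ] q ∈ final × Σ (Point → R) λ r → Tiling ℓ r q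
    decode (θ , local , q , q∈ , rec) = q , q∈ , r , record
      { leaves    = λ a → leaf-allowed a (local (a , 0))
      ; nodes     = λ a b → node-allowed a b (local (a , suc b))
      ; recurrent = λ x → let (y , (c , h , on) , later) = rec x in
          y , subst (OnPath q) (Has-unique {θ} h (r-has y)) on , still-later x later
      }
      where
      labelled : ∀ x → ∃[ c ] Has θ x c
      labelled x with local x
      ... | inj₁ (_ , c , _ , _ , h , _) = c , h
      ... | inj₂ (_ , _ , c , _ , h , _) = c , h

      r : Point → R
      r x = proj₁ (labelled x)

      r-has : ∀ x → Has θ x (r x)
      r-has x = proj₂ (labelled x)

      leaf-allowed : ∀ a → LocallyAllowed (letterUULS k ℓ) θ (a , 0) → LeafAllowed (ℓ (a , 0)) (r (a , 0))
      leaf-allowed a (inj₁ (_ , _ , _ , _ , _ , sons , _)) with () ← proj₁ (proj₂ (sons zero))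
      leaf-allowed a (inj₂ (_ , l , c , t , h , ok)) =
        subst₂ LeafAllowed (sym (letter⁻ {l} t)) (Has-unique {θ} h (r-has _)) ok

      node-allowed : ∀ a b → LocallyAllowed (letterUULS k ℓ) θ (a , suc b) →
        NodeAllowed (ℓ (a , suc b)) (r (a , suc b)) (tabulate λ (i : Fin k) → r (a * k + toℕ i , b))
      node-allowed a b (inj₂ (¬son , _)) = ⊥-elim (¬son (_ , refl))
      node-allowed a b (inj₁ (l , c , cs , t , h , sons , ok)) =
        subst₂ (λ x (c , cs) → NodeAllowed x c cs) (sym (letter⁻ {l} t))
          (cong₂ _,_ (Has-unique {θ} h (r-has _)) (sym (tabulate-lookup son≡))) ok
        where
        son≡ : ∀ i → r (a * k + toℕ i , b) ≡ lookup cs i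
        son≡ i with sons i
        ... | _ , refl , h′ = Has-unique {θ} (r-has _) h′

      still-later : ∀ x {y} → ¬ (∃[ c ] Has θ x c × Leftmost c) ⊎ Inorder k x y →
                    ¬ Leftmost (r x) ⊎ Inorder k x y
      still-later x (inj₁ ¬on) = inj₁ λ on → ¬on (r x , r-has x , on)
      still-later x (inj₂ x<y) = inj₂ x<y

    encode : (∃[ q ] q ∈ final × Σ (Point → R) λ r → Tiling ℓ r q) → ∃[ θ ] EncodesRun (letterUULS k ℓ) θ
    encode (q , q∈ , r , tiling) = θ , local , q , q∈ , λ x →
      let (y , on , later) = recurrent x in y , (r y , Has-characteristic r y , on) , still-later x later
      where
      open Tiling tiling
      θ = characteristic r

      local : ∀ x → LocallyAllowed (letterUULS k ℓ) θ x
      local (a , zero)  = inj₂ ((λ ()) , _ , _ , letter⁺ (a , 0) , Has-characteristic r _ , leaves a)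
      local (a , suc b) = inj₁ (_ , _ , _ , letter⁺ (a , suc b) , Has-characteristic r _ ,
        (λ i → _ , refl , subst (Has θ _) (sym (lookup∘tabulate (λ (i : Fin k) → r (a * k + toℕ i , b)) i))
                            (Has-characteristic r _)) ,
        nodes a b)

      still-later : ∀ x {y} → ¬ Leftmost (r x) ⊎ Inorder k x y →
                    ¬ (∃[ c ] Has θ x c × Leftmost c) ⊎ Inorder k x y
      still-later x (inj₁ ¬on) = inj₁ λ (c , h , on) →
        ¬on (subst Leftmost (Has-unique {θ} h (Has-characteristic r x)) on)
      still-later x (inj₂ x<y) = inj₂ x<y

-- Passage to tree sequences and the two translations

L-cong : ∀ {k A} (X : SeqAutomaton k A) {g g′ : 𝓢 k A} → g ≗ g′ → L X g → L X g′
L-cong X g≗g′ (σ , σ₀ , steps , rest) = σ , σ₀ ,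
  (λ i → let (B , δ , run) = steps i in B , δ , subst (Lᵗ (lookup (SeqAutomaton.Γ X) B)) (g≗g′ i) run) , rest

module _ (em : ExcludedMiddle 0ℓ) (k₂ : ℕ) where
  open Geometry k₂

  ITS-sequence : ∀ {A} (ℓ : Point → A) {g} → g ≗ sequence k ℓ → ITS k A g
  ITS-sequence ℓ g≗ i = cong proj₁ (g≗ i)

  ITS⇒sequence : ∀ {A} {g : 𝓢 k A} → ITS k A g → ∃[ ℓ ] g ≗ sequence k ℓ
  ITS⇒sequence {A} {g} its = unslice slices , λ i →
    trans (slices≡ i) (cong (i ,_) (sym (slice-unslice slices i)))
    where
    slices : ∀ i → Almost k A i
    slices i = subst (Almost k A) (its i) (proj₂ (g i))
    slices≡ : ∀ i → g i ≡ (i , slices i)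
    slices≡ i with g i | its i
    ... | _ , t | refl = refl

  automaton-definable : ∀ s (X : SeqAutomaton k (Fin s)) →
    ∃[ φ ] (L X ∩ ITS k (Fin s)) ≐ asLetterSequences {k} {s} (𝓜 φ)
  automaton-definable s X = proj₁ definable-run ,
    (λ (acc , its) → let (ℓ , g≗) = ITS⇒sequence its in
      ℓ , from (meaning ℓ) (L-cong X g≗ acc) , g≗) ,
    (λ (ℓ , sat , g≗) → L-cong X (sym ∘ g≗) (to (meaning ℓ) sat) , ITS-sequence ℓ g≗)
    where
    open RunFormula em k₂ X
    open Runs em k₂ X
    meaning : ∀ ℓ → 𝓜 (proj₁ definable-run) (letterUULS k ℓ) ⇔ L X (sequence k ℓ)
    meaning ℓ = mk⇔
      (from (L⇔tiling ℓ) ∘ to (run⇔tiling ℓ) ∘ to (proj₂ definable-run (letterUULS k ℓ) [] []))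
      (from (proj₂ definable-run (letterUULS k ℓ) [] []) ∘ from (run⇔tiling ℓ) ∘ to (L⇔tiling ℓ))

  sentence-recognizable : ∀ p (φ : Sentence k p) →
    ∃[ X ] asSequences (𝓜 φ) ≐ (L {k} {Subset p} X ∩ ITS k (Subset p))
  sentence-recognizable p φ = sequenceAutomaton R ,
    (λ (t , sat , g≗) → L-cong (sequenceAutomaton R) (sym ∘ g≗) (from (meaning t) sat) , ITS-sequence (labels t) g≗) ,
    (λ (acc , its) →
      let (ℓ , g≗) = ITS⇒sequence its
          t = uuls λ P x → lookup (ℓ x) P
          g≗t = λ i → trans (g≗ i) (cong (i ,_) (slice-cong (λ x → sym (tabulate∘lookup (ℓ x))) i))
      in t , to (meaning t) (L-cong (sequenceAutomaton R) g≗t acc) , g≗t)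
    where
    open Recognizers em k₂
    open Translation em k₂
    open Automata em k₂
    -- A sentence has no free variables, so only the track of the predicates is present.
    addTracks : Subset p → Letter 0 0 p
    addTracks w = [] , [] , w
    R : Recognizer (Subset p)
    R = relabel addTracks (proj₁ (translate φ))
    meaning : ∀ t → L (sequenceAutomaton R) (sequence k (labels t)) ⇔ 𝓜 φ t
    meaning t = mk⇔
      (to (proj₂ (translate φ) t [] []) ∘ to (relabel-Accepts addTracks (proj₁ (translate φ)) (labels t))
        ∘ to (sequenceAutomaton-L R (labels t)))
      (from (sequenceAutomaton-L R (labels t)) ∘ from (relabel-Accepts addTracks (proj₁ (translate φ)) (labels t))
        ∘ from (proj₂ (translate φ) t [] []))

theorem3p6 : ExcludedMiddle 0ℓ → (k : ℕ) → 2 ≤ k →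
    ((s : ℕ) (A : SeqAutomaton k (Fin s)) →
    ∃[ φ ] (L A ∩ ITS k (Fin s)) ≐ asLetterSequences {k} {s} (𝓜 φ))
    × ((p : ℕ) (φ : Sentence k p) →
    ∃[ A ] asSequences (𝓜 φ) ≐ (L {k} {Subset p} A ∩ ITS k (Subset p)))
theorem3p6 em (suc (suc k₂)) (s≤s (s≤s z≤n)) = automaton-definable em k₂ , sentence-recognizable em k₂
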